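{- Let $P=P(m_1,\dots,m_{n-1})$ be a natural unit interval order on $[n]$ and let $G=\mathrm{inc}(P)$. Suppose $m_1=r<n$ and $m_{r+1}=n$. Then there is a positive integer $k$ such that $$X_G(\mathbf{x},t)=\sum_{\ell=0}^{k}C_{(n-\ell,\ell)}(t)\,e_{(n-\ell,\ell)},\qquad C_{(n-\ell,\ell)}(t)=\sum_{T\in\overline{\mathcal{T}'}_{P,2^\ell1^{n-2\ell}}}t^{\mathrm{inv}_G(T)},$$ where $\overline{\mathcal{T}'}_{P,2^\ell1^{n-2\ell}}$ is the set of $P$-tableaux $T=[a_{i,j}]$ of shape $2^\ell1^{n-2\ell}$ for which there is no $s\ge \ell+2$ such that $a_{i,1}<_P a_{s,1}$ for all $i\in\{\ell+1,\ell+2,\dots,s-1\}$. Consequently $X_G(\mathbf{x},t)$ is $e$-positive, i.e. each $C_{(n-\ell,\ell)}(t)$ has nonnegative coefficients.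
   Context: A natural unit interval order $P(m_1,\dots,m_{n-1})$ is defined for integers $m_1\le\cdots\le m_{n-1}\le n$ with $m_i\ge i$: it is the poset on $[n]$ with $i<_P j$ iff $i<n$ and $j\in\{m_i+1,\dots,n\}$. Its incomparability graph $\mathrm{inc}(P)$ has vertex set $[n]$ and an edge $\{i,j\}$ ($i<j$) iff $j\le m_i$. The chromatic quasisymmetric function of a graph $G$ on $V\subset\mathbb{P}$ is $X_G(\mathbf{x},t)=\sum_\kappa t^{\mathrm{asc}(\kappa)}\prod_{v}x_{\kappa(v)}$ over proper colorings $\kappa:V\to\mathbb{P}$, with $\mathrm{asc}(\kappa)$ the number of edges $\{i,j\}$, $i<j$, with $\kappa(i)<\kappa(j)$. $e_\lambda=e_{\lambda_1}e_{\lambda_2}\cdots$ is the elementary symmetric function, with $e_{(n,0)}=e_n$. A $P$-tableau of shape $\lambda\vdash n$ is a filling $T=[a_{i,j}]$ of the Young diagram of $\lambda$ (English notation, $a_{i,j}$ in row $i$, column $j$) using each element of $P$ exactly once, such that $a_{i,j}<_P a_{i,j+1}$ for all $i,j$ and $a_{i+1,j}\not<_P a_{i,j}$ for all $i,j$. The shape $2^\ell1^{n-2\ell}$ has $\ell$ rows of length $2$ followed by $n-2\ell$ rows of length $1$. For $G=\mathrm{inc}(P)$ and a $P$-tableau $T$, a $G$-inversion of $T$ is an edge $\{i,j\}$ of $G$ with $i<j$ and $i$ in a lower row than $j$ in $T$; $\mathrm{inv}_G(T)$ is the number of $G$-inversions. -}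

module Defs where

open import Data.Bool using (if_then_else_)
open import Data.Fin as Fin using (Fin; toℕ)
import Data.Fin.Properties as Fin
open import Data.Integer as ℤ using (ℤ)
open import Data.List as List using (List; []; _∷_; _++_; allFin; cartesianProduct; cartesianProductWith; concat; filter; foldr; head; length; map; mapMaybe; replicate; upTo; zip)
import Data.List.Properties as List
open import Data.List.Membership.DecPropositional using (_∈?_)
open import Data.List.Relation.Unary.All as All using (All)
open import Data.List.Relation.Unary.Linked using (Linked; linked?)
open import Data.Nat as ℕ using (ℕ; zero; suc; _+_; _*_; _∸_; _≤_; _<_; _≥_)
import Data.Nat.Properties as ℕ
open import Data.Product using (∃-syntax; _×_; _,_; proj₁; proj₂)
open import Data.Sum as Sum using (_⊎_; inj₁; inj₂)
open import Data.Vec as Vec using (Vec; []; _∷_)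
import Data.Vec.Properties as Vec
import Data.Vec.Relation.Unary.All as VecAll
open import Relation.Binary using (Decidable)
open import Relation.Binary.PropositionalEquality using (_≡_; _≢_; refl)
open import Relation.Nullary using (¬_; Dec; does; ¬?; _×-dec_; _⊎-dec_; _→-dec_)
open import Relation.Nullary.Decidable using (map′)

------------------------------------------------------------------------
-- Polynomials in t over ℤ: coefficient lists, constant term first,
-- compared coefficientwise (so trailing zeros are irrelevant).

Poly : Set
Poly = List ℤ

coeff : Poly → ℕ → ℤ
coeff []      _       = ℤ.0ℤ
coeff (a ∷ p) zero    = a
coeff (a ∷ p) (suc d) = coeff p d

infix 4 _≈ₚ_
_≈ₚ_ : Poly → Poly → Set
p ≈ₚ q = ∀ d → coeff p d ≡ coeff q d

NonNegative : Poly → Set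
NonNegative p = ∀ d → ℤ.0ℤ ℤ.≤ coeff p d

0ₚ 1ₚ : Poly
0ₚ = []
1ₚ = ℤ.1ℤ ∷ []

t^_ : ℕ → Poly
t^ d = replicate d ℤ.0ℤ ++ 1ₚ

infixl 6 _+ₚ_
_+ₚ_ : Poly → Poly → Poly
[]      +ₚ q       = q
(a ∷ p) +ₚ []      = a ∷ p
(a ∷ p) +ₚ (b ∷ q) = (a ℤ.+ b) ∷ (p +ₚ q)

infixl 7 _*ₚ_
_*ₚ_ : Poly → Poly → Poly
[]      *ₚ q = []
(a ∷ p) *ₚ q = map (a ℤ.*_) q +ₚ (ℤ.0ℤ ∷ (p *ₚ q))

∑ₚ : List Poly → Poly
∑ₚ = foldr _+ₚ_ 0ₚ

------------------------------------------------------------------------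
-- Formal power series in x₁, x₂, … over ℤ[t].  The vector (α₁,…,α_N)
-- stands for the monomial x₁^α₁ ⋯ x_N^α_N; a series gives the
-- coefficient of every monomial, whatever the number N of variables
-- that are written down.

Series : Set
Series = ∀ {N} → Vec ℕ N → Poly

infix 4 _≈ₛ_
_≈ₛ_ : Series → Series → Set
f ≈ₛ g = ∀ {N} (α : Vec ℕ N) → f α ≈ₚ g α

-- All (β , γ) with x^β x^γ = x^α.
splits : ∀ {N} → Vec ℕ N → List (Vec ℕ N × Vec ℕ N)
splits []      = ([] , []) ∷ []
splits (a ∷ α) = cartesianProductWith
  (λ b βγ → (b ∷ proj₁ βγ) , ((a ∸ b) ∷ proj₂ βγ)) (upTo (suc a)) (splits α)

0ₛ 1ₛ : Series
0ₛ α = 0ₚ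
1ₛ α = if does (VecAll.all? (ℕ._≟ 0) α) then 1ₚ else 0ₚ

_+ₛ_ : Series → Series → Series
(f +ₛ g) α = f α +ₚ g α

_*ₛ_ : Series → Series → Series
(f *ₛ g) α = ∑ₚ (map (λ βγ → f (proj₁ βγ) *ₚ g (proj₂ βγ)) (splits α))

infixr 7 _·_
_·_ : Poly → Series → Series
(c · f) α = c *ₚ f α

∑[ℓ≤_]_ : ℕ → (ℕ → Series) → Series
(∑[ℓ≤ k ] f) α = ∑ₚ (map (λ ℓ → f ℓ α) (upTo (suc k)))

-- The elementary symmetric function e_k is the sum of all squarefree
-- monomials of degree k.
e : ℕ → Series
e k α = if does (VecAll.all? (ℕ._≤? 1) α ×-dec (Vec.sum α ℕ.≟ k)) then 1ₚ else 0ₚ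

e[_] : List ℕ → Series
e[ [] ]    = 1ₛ
e[ k ∷ λs ] = e k *ₛ e[ λs ]

IsPartition : List ℕ → Set
IsPartition λs = Linked _≥_ λs × All (1 ≤_) λs

eCombination : List (Poly × List ℕ) → Series
eCombination []             = 0ₛ
eCombination ((c , λs) ∷ cs) = (c · e[ λs ]) +ₛ eCombination cs

EPositive : Series → Set
EPositive f = ∃[ cs ] All (λ cλ → NonNegative (proj₁ cλ) × IsPartition (proj₂ cλ)) cs
                    × (f ≈ₛ eCombination cs)

------------------------------------------------------------------------
-- Graphs on [n] and their chromatic quasisymmetric functions

-- The vertex or poset element i : Fin n is the integer label i ∈ [n].
label : ∀ {n} → Fin n → ℕ
label i = suc (toℕ i)

record Graph (n : ℕ) : Set₁ where
  field
    Adj    : Fin n → Fin n → Set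
    adj?   : Decidable Adj
    sym    : ∀ {i j} → Adj i j → Adj j i
    irrefl : ∀ {i} → ¬ Adj i i

-- All vectors of length k with entries in the given list.
vectors : {A : Set} → List A → (k : ℕ) → List (Vec A k)
vectors as zero    = [] ∷ []
vectors as (suc k) = cartesianProductWith _∷_ as (vectors as k)

module _ {n : ℕ} (G : Graph n) where
  open Graph G

  -- Each edge {i , j} is listed once, as (i , j) with i < j.
  edges : List (Fin n × Fin n)
  edges = filter (λ ij → (proj₁ ij Fin.<? proj₂ ij) ×-dec adj? (proj₁ ij) (proj₂ ij))
                 (cartesianProduct (allFin n) (allFin n))

  module _ {N : ℕ} (κ : Vec (Fin N) n) where

    Proper : Set
    Proper = ∀ i j → Adj i j → Vec.lookup κ i ≢ Vec.lookup κ j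

    proper? : Dec Proper
    proper? = Fin.all? λ i → Fin.all? λ j →
      adj? i j →-dec ¬? (Vec.lookup κ i Fin.≟ Vec.lookup κ j)

    asc : ℕ
    asc = length (filter (λ ij → Vec.lookup κ (proj₁ ij) Fin.<? Vec.lookup κ (proj₂ ij)) edges)

    -- The exponent vector of ∏_v x_{κ(v)}.
    content : Vec ℕ N
    content = Vec.tabulate λ c → Vec.count (c Fin.≟_) κ

  -- A colouring κ : [n] → ℙ with ∏_v x_{κ(v)} = x₁^α₁ ⋯ x_N^α_N only uses
  -- the colours 1,…,N, so it is a vector of elements of Fin N.
  coloringsWithContent : ∀ {N} → Vec ℕ N → List (Vec (Fin N) n)
  coloringsWithContent {N} α =
    filter (λ κ → proper? κ ×-dec Vec.≡-dec ℕ._≟_ (content κ) α) (vectors (allFin N) n)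

  chromatic : Series
  chromatic α = ∑ₚ (map (λ κ → t^ (asc κ)) (coloringsWithContent α))

------------------------------------------------------------------------
-- Natural unit interval orders

-- Only m₁,…,m_{n-1} are data of the order.  The value m_n = n is the usual
-- convention, and the values of m outside {1,…,n} are never used.
record NaturalUnitIntervalOrder (n : ℕ) : Set where
  field
    m       : ℕ → ℕ
    m-lower : ∀ {i} → 1 ≤ i → i < n → i ≤ m i
    m-mono  : ∀ {i j} → 1 ≤ i → i ≤ j → j < n → m i ≤ m j
    m-upper : ∀ {i} → 1 ≤ i → i < n → m i ≤ n
    m-last  : m n ≡ n

module _ {n : ℕ} (P : NaturalUnitIntervalOrder n) where
  open NaturalUnitIntervalOrder P

  _<P_ : Fin n → Fin n → Set
  i <P j = label i < n × m (label i) < label j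

  _<P?_ : Decidable _<P_
  i <P? j = (label i ℕ.<? n) ×-dec (m (label i) ℕ.<? label j)

  IncEdge : Fin n → Fin n → Set
  IncEdge i j = i Fin.< j × label j ≤ m (label i)

  incEdge? : Decidable IncEdge
  incEdge? i j = (i Fin.<? j) ×-dec (label j ℕ.≤? m (label i))

  inc : Graph n
  inc = record
    { Adj    = λ i j → IncEdge i j ⊎ IncEdge j i
    ; adj?   = λ i j → incEdge? i j ⊎-dec incEdge? j i
    ; sym    = Sum.swap
    ; irrefl = λ { (inj₁ (i<i , _)) → ℕ.<-irrefl refl i<i
                 ; (inj₂ (i<i , _)) → ℕ.<-irrefl refl i<i }
    }

------------------------------------------------------------------------
-- P-tableaux

-- A filling is the list of its rows, from top to bottom.
Filling : ℕ → Set
Filling n = List (List (Fin n))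

fillings : ∀ {n} → List ℕ → List (Filling n)
fillings []           = [] ∷ []
fillings {n} (k ∷ λs) =
  cartesianProductWith _∷_ (map Vec.toList (vectors (allFin n) k)) (fillings λs)

-- The index, counted from 0 at the top, of the row containing v.
row : ∀ {n} → Filling n → Fin n → ℕ
row []      v = 0
row (R ∷ T) v = if does (_∈?_ Fin._≟_ v R) then 0 else suc (row T v)

firstColumn : ∀ {n} → Filling n → List (Fin n)
firstColumn = mapMaybe head

-- The number of edges {i , j} of G, i < j, with i in a lower row than j.
inv : ∀ {n} → Graph n → Filling n → ℕ
inv G T = length (filter (λ ij → row T (proj₂ ij) ℕ.<? row T (proj₁ ij)) (edges G))

-- The shape 2^ℓ 1^(n-2ℓ).
twoColumn : ℕ → ℕ → List ℕ
twoColumn n ℓ = replicate ℓ 2 ++ replicate (n ∸ 2 * ℓ) 1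

module _ {n : ℕ} (P : NaturalUnitIntervalOrder n) where

  private
    _≺_ : Fin n → Fin n → Set
    _≺_ = _<P_ P

    _≺?_ : Decidable _≺_
    _≺?_ = _<P?_ P

  -- For row R directly above row S: zip pairs a_{i,j} with a_{i+1,j}
  -- in the columns that both rows reach.
  ColumnsOK : List (Fin n) → List (Fin n) → Set
  ColumnsOK R S = All (λ ab → ¬ (proj₂ ab ≺ proj₁ ab)) (zip R S)

  record IsPTableau (λs : List ℕ) (T : Filling n) : Set where
    field
      shape    : map length T ≡ λs
      eachOnce : ∀ v → length (filter (v Fin.≟_) (concat T)) ≡ 1
      rows     : All (Linked _≺_) T
      columns  : Linked ColumnsOK T

  isPTableau? : ∀ λs T → Dec (IsPTableau λs T)
  isPTableau? λs T = map′
    (λ { (s , o , r , c) → record { shape = s ; eachOnce = o ; rows = r ; columns = c } })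
    (λ T✓ → let open IsPTableau T✓ in shape , eachOnce , rows , columns)
    (List.≡-dec ℕ._≟_ (map length T) λs
      ×-dec Fin.all? (λ v → length (filter (v Fin.≟_) (concat T)) ℕ.≟ 1)
      ×-dec All.all? (linked? _≺?_) T
      ×-dec linked? (λ R S → All.all? (λ ab → ¬? (proj₂ ab ≺? proj₁ ab)) (zip R S)) T)

  -- There is s ≥ ℓ + 2 with a_{i,1} <_P a_{s,1} for all ℓ + 1 ≤ i ≤ s - 1;
  -- the position s : Fin _ has row number suc (toℕ s).
  Excluded : ℕ → Filling n → Set
  Excluded ℓ T = ∃[ s ] ℓ + 2 ≤ suc (toℕ s)
    × (∀ i → ℓ + 1 ≤ suc (toℕ i) → i Fin.< s
           → List.lookup (firstColumn T) i ≺ List.lookup (firstColumn T) s)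

  excluded? : ∀ ℓ T → Dec (Excluded ℓ T)
  excluded? ℓ T = Fin.any? λ s → (ℓ + 2 ℕ.≤? suc (toℕ s)) ×-dec
    Fin.all? λ i → (ℓ + 1 ℕ.≤? suc (toℕ i)) →-dec (i Fin.<? s) →-dec
      (List.lookup (firstColumn T) i ≺? List.lookup (firstColumn T) s)

  -- The set of tableaux over which C_{(n-ℓ,ℓ)}(t) is summed.
  tableaux : ℕ → List (Filling n)
  tableaux ℓ = filter (λ T → isPTableau? (twoColumn n ℓ) T ×-dec ¬? (excluded? ℓ T))
                      (fillings (twoColumn n ℓ))

  C : ℕ → Poly
  C ℓ = ∑ₚ (map (λ T → t^ (inv (inc P) T)) (tableaux ℓ))

{-# OPTIONS --safe #-}

-- Since m₁ = r and m_{r+1} = n, the order P has no chain a ≺ b ≺ c, so all colour classes and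
-- rows have at most two elements.  Fix the power of t and let Y(α | p) be the number of fillings
-- with upper rows of lengths α, all of them chains, followed by p rows of length 1 without descents
-- x_{i+1} ≺ x_i.
--   * A Bender–Knuth involution shows that Y(α | p) is symmetric in α; colourings are the case p = 0.
--   * Splitting according to whether the last upper row forms a descent with the first letter,
--     Y(1,β | p+1) = Y(β | p+2) + Y(2,β | p), and Y(1,β | 0) = Y(β | 1).
--   * In an excluded tableau the column below row ℓ starts with a, x₁, …, x_j, b where b lies above all the
--     preceding letters.  Moving b next to a gives Y(2^ℓ | p+2) = C_ℓ + Y(2^(ℓ+1) | p).
-- These recursions express the coefficient of x^α, for α with s ones and q twos, as
-- ∑_ℓ (s choose ℓ − q) C_ℓ, and s choose ℓ − q is the coefficient of x^α in e_{n-ℓ} e_ℓ.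
module Submission where

open import Defs
open import Data.Bool using (if_then_else_)
open import Data.Empty using (⊥; ⊥-elim)
open import Data.Fin as Fin using (Fin; zero; suc; toℕ)
import Data.Fin.Properties as Fin
open import Data.Integer as ℤ using (ℤ) renaming (+_ to ⁺_)
import Data.Integer.Properties as ℤ
open import Data.List as List using (List; _∷_; []; [_]; _++_; _ʳ++_; allFin; applyUpTo; cartesianProduct; cartesianProductWith; concat; filter; length; lookup; map; replicate; tabulate; upTo)
import Data.List.Properties as List
open import Data.List.Properties using (++-assoc; ++-identityʳ; ∷-injective; ∷-injectiveʳ; ∷-injectiveˡ; filter-accept; filter-reject; length-++; length-map; length-replicate; length-tabulate; map-++; map-cong; map-tabulate; map-upTo; map-ʳ++; map-∘; tabulate-lookup)
open import Data.List.Membership.DecPropositional using (_∈?_)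
open import Data.List.Membership.Propositional using (_∈_; _∉_)
open import Data.List.Membership.Propositional.Properties
open import Data.List.Membership.Propositional.Properties.WithK using (unique∧set⇒bag)
open import Data.List.Relation.Binary.BagAndSetEquality using (∼bag⇒↭)
open import Data.List.Relation.Binary.Disjoint.Propositional using (Disjoint)
import Data.List.Relation.Binary.Permutation.Propositional as ↭
open import Data.List.Relation.Binary.Permutation.Propositional using (_↭_; refl; prep; swap; ↭-refl; ↭-reflexive; ↭-sym; ↭-trans)
open import Data.List.Relation.Binary.Permutation.Propositional.Properties using (++⁺ʳ; ++⁺ˡ; ++↭ʳ++; All-resp-↭; filter-↭; map⁺; shift; shifts; ↭-length)
open import Data.List.Relation.Unary.All as All using (All; []; _∷_)
import Data.List.Relation.Unary.All.Properties as All
open import Data.List.Relation.Unary.AllPairs as AllPairs using (AllPairs; []; _∷_)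
import Data.List.Relation.Unary.AllPairs.Properties as AllPairs
open import Data.List.Relation.Unary.Any as Any using (Any; here; there)
import Data.List.Relation.Unary.Any.Properties as Any
open import Data.List.Relation.Unary.Linked as Linked using (Linked; []; [-]; _∷_; linked?)
import Data.List.Relation.Unary.Linked.Properties as Linked
open import Data.List.Relation.Unary.Unique.Propositional using (Unique)
import Data.List.Relation.Unary.Unique.Propositional.Properties as Unique
open import Data.Nat as ℕ using (ℕ; zero; suc; _+_; _*_; _∸_; _≤_; _<_; z≤n; s≤s)
open import Data.Nat.ListAction using (sum)
open import Data.Nat.ListAction.Properties using (sum-++; sum-↭)
import Data.Nat.Properties as ℕ
open import Data.Nat.Solver using (module +-*-Solver)
open import Data.Product using (_×_; _,_; proj₁; proj₂; ∃-syntax; ∃₂)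
open import Data.Sum using (_⊎_; inj₁; inj₂)
open import Data.Unit using (⊤; tt)
open import Data.Vec as Vec using (Vec; []; _∷_; toList)
import Data.Vec.Properties as Vec
open import Data.Vec.Relation.Unary.All as VecAll using ([]; _∷_)
open import Data.Vec.Relation.Unary.Any as VecAny using (here; there)
open import Function using (_∘_; flip; id)
open import Function.Bundles using (mk⇔)
open import Relation.Binary using (Decidable; tri<; tri≈; tri>)
open import Relation.Binary.PropositionalEquality using (_≡_; _≢_; refl; sym; trans; cong; cong₂; subst; subst₂; module ≡-Reasoning)
open import Relation.Nullary using (¬_; Dec; yes; no; does; _×-dec_; ¬?)
import Relation.Unary as U
open import Relation.Unary using (_⟨⊎⟩_)
open NaturalUnitIntervalOrder using (m)

-- For fixed `d`, both sides are natural numbers, namely coefficients of x^α t^d, and every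
-- recursion comes from a bijection that keeps the weight. Comparable letters are not joined by an
-- edge and may pass each other freely. The delicate case is a row a ≺ b next to a letter x with
-- neither x ≺ b nor a ≺ x: monotonicity of `m` puts x between a and b, and it makes exactly one
-- inversion with that row from either side. Symmetry in α closes the recursion: a descent creates a
-- row of length 2 in front of the remaining rows of length 1, and it has to move behind them before
-- the next step. Under the recursion p performs a walk on ℕ, up by one without a descent and down
-- by one with a descent. Because p cannot become negative, the multiplicities are sums of p + 1
-- binomial coefficients, which collapse to a single one at p = 0, the case of colourings. Absence
-- of chains a ≺ b ≺ c also does local work throughout: a letter with something above it is minimal,
-- so it can be put in front of any letter without creating a descent.

private
  variable
    A B : Set
    n N : ℕ

-- Counting by duplicate-free enumerations and bijections

record Enumerates (P : A → Set) (xs : List A) : Set where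
  field
    unique   : Unique xs
    sound    : ∀ {x} → x ∈ xs → P x
    complete : ∀ {x} → P x → x ∈ xs

open Enumerates

infix 4 _≅_
-- A bijection between the subsets cut out by `P` and `Q`. Elements are raw data, so different
-- proofs of `P x` are never counted separately, and `to` may take arbitrary values outside `P`.
record _≅_ (P : A → Set) (Q : B → Set) : Set where
  field
    to         : A → B
    to-∈       : ∀ {x} → P x → Q (to x)
    injective  : ∀ {x y} → P x → P y → to x ≡ to y → x ≡ y
    surjective : ∀ {y} → Q y → ∃[ x ] P x × to x ≡ y

fromInverse : {P : A → Set} {Q : B → Set} (to : A → B) (from : B → A) →
  (∀ {x} → P x → Q (to x) × from (to x) ≡ x) →
  (∀ {y} → Q y → P (from y) × to (from y) ≡ y) → P ≅ Q
fromInverse to from to✓ from✓ = record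
  { to         = to
  ; to-∈       = λ p → proj₁ (to✓ p)
  ; injective  = λ p q eq → trans (sym (proj₂ (to✓ p))) (trans (cong from eq) (proj₂ (to✓ q)))
  ; surjective = λ q → from _ , from✓ q
  }

unique-map : {P : A → Set} {f : A → B} → (∀ {x y} → P x → P y → f x ≡ f y → x ≡ y) →
  ∀ {xs} → All P xs → Unique xs → Unique (map f xs)
unique-map inj []         []         = []
unique-map inj (px ∷ pxs) (x∉ ∷ xs!) =
  All.map⁺ (All.zipWith (λ { (py , x≢y) eq → x≢y (inj px py eq) }) (pxs , x∉)) ∷ unique-map inj pxs xs!

≅⇒length≡ : {P : A → Set} {Q : B → Set} → P ≅ Q →
  ∀ {xs ys} → Enumerates P xs → Enumerates Q ys → length xs ≡ length ys
≅⇒length≡ {P = P} f {xs} {ys} exs eys = trans (sym (length-map to xs)) (↭-length map↭ys)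
  where
  open _≅_ f
  map↭ys : map to xs ↭ ys
  map↭ys = ∼bag⇒↭ (unique∧set⇒bag
    (unique-map injective (All.tabulate (sound exs)) (unique exs)) (unique eys)
    (mk⇔ (λ y∈ → let (_ , x∈ , eq) = ∈-map⁻ to y∈ in
                  subst (_∈ ys) (sym eq) (complete eys (to-∈ (sound exs x∈))))
         (λ y∈ → let (_ , px , eq) = surjective (sound eys y∈) in
                  subst (_∈ map to xs) eq (∈-map⁺ to (complete exs px)))))

enumerates-filter : {P Q : A → Set} (Q? : U.Decidable Q) {xs : List A} →
  Enumerates P xs → Enumerates (λ x → P x × Q x) (filter Q? xs)
enumerates-filter Q? {xs} exs = record
  { unique   = Unique.filter⁺ Q? (unique exs)
  ; sound    = λ x∈ → let (x∈xs , qx) = ∈-filter⁻ Q? {xs = xs} x∈ in sound exs x∈xs , qx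
  ; complete = λ (px , qx) → ∈-filter⁺ Q? (complete exs px) qx
  }

enumerates-⊎ : {P : A → Set} {Q : B → Set} {xs : List A} {ys : List B} →
  Enumerates P xs → Enumerates Q ys → Enumerates (P ⟨⊎⟩ Q) (map inj₁ xs ++ map inj₂ ys)
enumerates-⊎ {P = P} {Q} {xs} {ys} exs eys = record
  { unique   = Unique.++⁺ (Unique.map⁺ (λ { refl → refl }) (unique exs))
                          (Unique.map⁺ (λ { refl → refl }) (unique eys)) disjoint
  ; sound    = sound-⊎
  ; complete = λ { {inj₁ x} px → ∈-++⁺ˡ (∈-map⁺ inj₁ (complete exs px))
                 ; {inj₂ y} qy → ∈-++⁺ʳ (map inj₁ xs) (∈-map⁺ inj₂ (complete eys qy)) }
  }
  where
  sound-⊎ : ∀ {z} → z ∈ map inj₁ xs ++ map inj₂ ys → (P ⟨⊎⟩ Q) z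
  sound-⊎ z∈ with ∈-++⁻ (map inj₁ xs) z∈
  ... | inj₁ z∈₁ with _ , x∈ , refl ← ∈-map⁻ inj₁ z∈₁ = sound exs x∈
  ... | inj₂ z∈₂ with _ , y∈ , refl ← ∈-map⁻ inj₂ z∈₂ = sound eys y∈
  disjoint : ∀ {z} → z ∈ map inj₁ xs × z ∈ map inj₂ ys → _
  disjoint (z∈₁ , z∈₂) with ∈-map⁻ inj₁ z∈₁ | ∈-map⁻ inj₂ z∈₂
  ... | _ , _ , refl | _ , _ , ()

≅⊎⇒length≡+ : {C : Set} {P : A → Set} {Q : B → Set} {R : C → Set} → P ≅ (Q ⟨⊎⟩ R) →
  ∀ {xs ys zs} → Enumerates P xs → Enumerates Q ys → Enumerates R zs →
  length xs ≡ length ys + length zs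
≅⊎⇒length≡+ f {xs} {ys} {zs} exs eys ezs = trans (≅⇒length≡ f exs (enumerates-⊎ eys ezs))
  (trans (length-++ (map inj₁ ys)) (cong₂ _+_ (length-map inj₁ ys) (length-map inj₂ zs)))

-- Coefficients of polynomials

coeff-+ₚ : ∀ p q d → coeff (p +ₚ q) d ≡ coeff p d ℤ.+ coeff q d
coeff-+ₚ []      q       d       = sym (ℤ.+-identityˡ _)
coeff-+ₚ (a ∷ p) []      d       = sym (ℤ.+-identityʳ _)
coeff-+ₚ (a ∷ p) (b ∷ q) zero    = refl
coeff-+ₚ (a ∷ p) (b ∷ q) (suc d) = coeff-+ₚ p q d

coeff-map-* : ∀ a p d → coeff (map (a ℤ.*_) p) d ≡ a ℤ.* coeff p d
coeff-map-* a []      d       = sym (ℤ.*-zeroʳ a)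
coeff-map-* a (b ∷ p) zero    = refl
coeff-map-* a (b ∷ p) (suc d) = coeff-map-* a p d

coeff-∑ₚ : ∀ {g : A → Poly} {h : A → ℕ} {d} → (∀ x → coeff (g x) d ≡ ⁺ h x) →
  ∀ xs → coeff (∑ₚ (map g xs)) d ≡ ⁺ sum (map h xs)
coeff-∑ₚ g≡h []       = refl
coeff-∑ₚ {g = g} {h} {d} g≡h (x ∷ xs) = begin
  coeff (g x +ₚ ∑ₚ (map g xs)) d               ≡⟨ coeff-+ₚ (g x) _ d ⟩
  coeff (g x) d ℤ.+ coeff (∑ₚ (map g xs)) d    ≡⟨ cong₂ ℤ._+_ (g≡h x) (coeff-∑ₚ g≡h xs) ⟩
  ⁺ h x ℤ.+ ⁺ sum (map h xs)                   ≡⟨ ℤ.pos-+ (h x) _ ⟨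
  ⁺ (h x + sum (map h xs))                     ∎
  where open ≡-Reasoning

coeff-t^-same : ∀ d → coeff (t^ d) d ≡ ℤ.1ℤ
coeff-t^-same zero    = refl
coeff-t^-same (suc d) = coeff-t^-same d

coeff-t^-other : ∀ {b d} → b ≢ d → coeff (t^ b) d ≡ ℤ.0ℤ
coeff-t^-other {zero}  {zero}  b≢d = ⊥-elim (b≢d refl)
coeff-t^-other {zero}  {suc d} b≢d = refl
coeff-t^-other {suc b} {zero}  b≢d = refl
coeff-t^-other {suc b} {suc d} b≢d = coeff-t^-other (b≢d ∘ cong suc)

coeff-∑ₚt^ : ∀ (f : A → ℕ) xs d →
  coeff (∑ₚ (map (λ x → t^ (f x)) xs)) d ≡ ⁺ length (filter (λ x → f x ℕ.≟ d) xs)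
coeff-∑ₚt^ f []       d = refl
coeff-∑ₚt^ f (x ∷ xs) d with f x ℕ.≟ d
... | yes fx≡d = begin
  coeff (t^ f x +ₚ rest) d            ≡⟨ coeff-+ₚ (t^ f x) rest d ⟩
  coeff (t^ f x) d ℤ.+ coeff rest d   ≡⟨ cong₂ ℤ._+_ (trans (cong (λ b → coeff (t^ b) d) fx≡d) (coeff-t^-same d)) (coeff-∑ₚt^ f xs d) ⟩
  ⁺ 1 ℤ.+ ⁺ length (filter f≟d xs)    ≡⟨ ℤ.pos-+ 1 _ ⟨
  ⁺ suc (length (filter f≟d xs))      ≡⟨ cong (λ ys → ⁺ length ys) (filter-accept f≟d fx≡d) ⟨
  ⁺ length (filter f≟d (x ∷ xs))      ∎
  where
  open ≡-Reasoning
  rest = ∑ₚ (map (λ y → t^ (f y)) xs)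
  f≟d = λ y → f y ℕ.≟ d
... | no fx≢d  = begin
  coeff (t^ f x +ₚ rest) d            ≡⟨ coeff-+ₚ (t^ f x) rest d ⟩
  coeff (t^ f x) d ℤ.+ coeff rest d   ≡⟨ cong₂ ℤ._+_ (coeff-t^-other fx≢d) (coeff-∑ₚt^ f xs d) ⟩
  ℤ.0ℤ ℤ.+ ⁺ length (filter f≟d xs)   ≡⟨ ℤ.+-identityˡ _ ⟩
  ⁺ length (filter f≟d xs)            ≡⟨ cong (λ ys → ⁺ length ys) (filter-reject f≟d fx≢d) ⟨
  ⁺ length (filter f≟d (x ∷ xs))      ∎
  where
  open ≡-Reasoning
  rest = ∑ₚ (map (λ y → t^ (f y)) xs)
  f≟d = λ y → f y ℕ.≟ d

const : ℕ → Poly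
const k = ⁺ k ∷ []

-- Products of elementary symmetric functions have coefficients constant in t, so this is the case
-- of multiplication that the expansion calls for.
≈const⇒coeff-*ₚ : ∀ {q k} → q ≈ₚ const k → ∀ p d → coeff (p *ₚ q) d ≡ coeff p d ℤ.* ⁺ k
≈const⇒coeff-*ₚ {q} {k} q≈k []      d       = refl
≈const⇒coeff-*ₚ {q} {k} q≈k (a ∷ p) zero    = begin
  coeff (map (a ℤ.*_) q +ₚ (ℤ.0ℤ ∷ (p *ₚ q))) 0   ≡⟨ coeff-+ₚ (map (a ℤ.*_) q) _ 0 ⟩
  coeff (map (a ℤ.*_) q) 0 ℤ.+ ℤ.0ℤ              ≡⟨ ℤ.+-identityʳ _ ⟩
  coeff (map (a ℤ.*_) q) 0                       ≡⟨ coeff-map-* a q 0 ⟩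
  a ℤ.* coeff q 0                                ≡⟨ cong (a ℤ.*_) (q≈k 0) ⟩
  a ℤ.* ⁺ k                                      ∎
  where open ≡-Reasoning
≈const⇒coeff-*ₚ {q} {k} q≈k (a ∷ p) (suc d) = begin
  coeff (map (a ℤ.*_) q +ₚ (ℤ.0ℤ ∷ (p *ₚ q))) (suc d)   ≡⟨ coeff-+ₚ (map (a ℤ.*_) q) _ (suc d) ⟩
  coeff (map (a ℤ.*_) q) (suc d) ℤ.+ coeff (p *ₚ q) d
    ≡⟨ cong₂ ℤ._+_ (trans (coeff-map-* a q (suc d)) (trans (cong (a ℤ.*_) (q≈k (suc d))) (ℤ.*-zeroʳ a)))
                   (≈const⇒coeff-*ₚ q≈k p d) ⟩
  ℤ.0ℤ ℤ.+ coeff p d ℤ.* ⁺ k                             ≡⟨ ℤ.+-identityˡ _ ⟩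
  coeff p d ℤ.* ⁺ k                                      ∎
  where open ≡-Reasoning

const-*ₚ : ∀ {p q a b} → p ≈ₚ const a → q ≈ₚ const b → (p *ₚ q) ≈ₚ const (a * b)
const-*ₚ {p} {q} {a} {b} p≈a q≈b d = trans (≈const⇒coeff-*ₚ q≈b p d) (trans (cong (ℤ._* ⁺ b) (p≈a d)) (lem d))
  where
  lem : ∀ d → coeff (const a) d ℤ.* ⁺ b ≡ coeff (const (a * b)) d
  lem zero    = sym (ℤ.pos-* a b)
  lem (suc d) = refl

const-∑ₚ : ∀ {g : A → Poly} {h : A → ℕ} → (∀ x → g x ≈ₚ const (h x)) →
  ∀ xs → ∑ₚ (map g xs) ≈ₚ const (sum (map h xs))
const-∑ₚ g≈h []       zero    = refl
const-∑ₚ g≈h []       (suc d) = refl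
const-∑ₚ {g = g} {h} g≈h (x ∷ xs) d =
  trans (coeff-+ₚ (g x) _ d) (trans (cong₂ ℤ._+_ (g≈h x d) (const-∑ₚ g≈h xs d)) (lem d))
  where
  lem : ∀ d → coeff (const (h x)) d ℤ.+ coeff (const (sum (map h xs))) d
            ≡ coeff (const (h x + sum (map h xs))) d
  lem zero    = sym (ℤ.pos-+ (h x) _)
  lem (suc d) = refl

-- Products of two elementary symmetric functions

-- Using a variable in a squarefree monomial of degree k leaves degree k - 1 for the others; the
-- value 0 at 0 records that degree 0 uses no variable.
↓ : (ℕ → ℕ) → ℕ → ℕ
↓ f zero    = 0
↓ f (suc k) = f k

isZero : ℕ → ℕ
isZero zero    = 1
isZero (suc _) = 0

eCoeff : ℕ → Vec ℕ N → ℕ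
eCoeff k       []                 = isZero k
eCoeff k       (0 ∷ α)            = eCoeff k α
eCoeff k       (1 ∷ α)            = ↓ (λ k′ → eCoeff k′ α) k
eCoeff k       (suc (suc _) ∷ α)  = 0

eCoeff-yes : ∀ (α : Vec ℕ N) {k} → VecAll.All (_≤ 1) α → Vec.sum α ≡ k → eCoeff k α ≡ 1
eCoeff-yes []      {zero}  []      eq = refl
eCoeff-yes (0 ∷ α)         (_ ∷ p) eq = eCoeff-yes α p eq
eCoeff-yes (1 ∷ α) {suc k} (_ ∷ p) eq = eCoeff-yes α p (ℕ.suc-injective eq)
eCoeff-yes (suc (suc _) ∷ α) (s≤s () ∷ p) eq

eCoeff-no : ∀ (α : Vec ℕ N) {k} → ¬ (VecAll.All (_≤ 1) α × Vec.sum α ≡ k) → eCoeff k α ≡ 0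
eCoeff-no []                {zero}  ¬p = ⊥-elim (¬p ([] , refl))
eCoeff-no []                {suc k} ¬p = refl
eCoeff-no (0 ∷ α)           {k}     ¬p = eCoeff-no α λ (q , eq) → ¬p (z≤n ∷ q , eq)
eCoeff-no (1 ∷ α)           {zero}  ¬p = refl
eCoeff-no (1 ∷ α)           {suc k} ¬p = eCoeff-no α λ (q , eq) → ¬p (s≤s z≤n ∷ q , cong suc eq)
eCoeff-no (suc (suc _) ∷ α) {k}     ¬p = refl

indicator≈const : {P : Set} (P? : Dec P) {k : ℕ} → (P → k ≡ 1) → (¬ P → k ≡ 0) →
  (if does P? then 1ₚ else 0ₚ) ≈ₚ const k
indicator≈const (yes p) k≡1 k≡0 d       rewrite k≡1 p  = refl
indicator≈const (no ¬p) k≡1 k≡0 zero    rewrite k≡0 ¬p = refl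
indicator≈const (no ¬p) k≡1 k≡0 (suc d) rewrite k≡0 ¬p = refl

e≈eCoeff : ∀ k (α : Vec ℕ N) → e k α ≈ₚ const (eCoeff k α)
e≈eCoeff k α = indicator≈const (VecAll.all? (ℕ._≤? 1) α ×-dec (Vec.sum α ℕ.≟ k))
  (λ (p , eq) → eCoeff-yes α p eq) (eCoeff-no α)

all0⇒sum≡0 : {α : Vec ℕ N} → VecAll.All (_≡ 0) α → Vec.sum α ≡ 0
all0⇒sum≡0 []         = refl
all0⇒sum≡0 (refl ∷ p) = all0⇒sum≡0 p

sum≡0⇒all0 : (α : Vec ℕ N) → Vec.sum α ≡ 0 → VecAll.All (_≡ 0) α
sum≡0⇒all0 []      eq = []
sum≡0⇒all0 (0 ∷ α) eq = refl ∷ sum≡0⇒all0 α eq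

1ₛ≈eCoeff : ∀ (α : Vec ℕ N) → 1ₛ α ≈ₚ const (eCoeff 0 α)
1ₛ≈eCoeff α = indicator≈const (VecAll.all? (ℕ._≟ 0) α)
  (λ p → eCoeff-yes α (VecAll.map (λ { refl → z≤n }) p) (all0⇒sum≡0 p))
  (λ ¬p → eCoeff-no α λ (_ , eq) → ¬p (sum≡0⇒all0 α eq))

-- The coefficient of x^α in e_x e_y, one variable at a time: exponent 1 comes from one of the two
-- factors, exponent 2 from both, and a larger exponent is impossible as both factors are
-- squarefree.
eeCoeff : ℕ → ℕ → Vec ℕ N → ℕ
eeCoeff x       y       []                      = isZero (x + y)
eeCoeff x       y       (0 ∷ α)                 = eeCoeff x y α
eeCoeff x       y       (1 ∷ α)                 = ↓ (λ x′ → eeCoeff x′ y α) x + ↓ (λ y′ → eeCoeff x y′ α) y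
eeCoeff x       y       (2 ∷ α)                 = ↓ (λ x′ → ↓ (λ y′ → eeCoeff x′ y′ α) y) x
eeCoeff x       y       (suc (suc (suc _)) ∷ α) = 0

sum-zero : ∀ {f : A → ℕ} → (∀ x → f x ≡ 0) → ∀ xs → sum (map f xs) ≡ 0
sum-zero f≡0 []       = refl
sum-zero f≡0 (x ∷ xs) = cong₂ _+_ (f≡0 x) (sum-zero f≡0 xs)

sum-cong : ∀ {f g : A → ℕ} → (∀ x → f x ≡ g x) → ∀ xs → sum (map f xs) ≡ sum (map g xs)
sum-cong f≡g xs = cong sum (map-cong f≡g xs)

sum-cartesianProductWith : ∀ {C : Set} (h : C → ℕ) (g : A → B → C) xs ys →
  sum (map h (cartesianProductWith g xs ys)) ≡ sum (map (λ x → sum (map (λ y → h (g x y)) ys)) xs)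
sum-cartesianProductWith h g []       ys = refl
sum-cartesianProductWith h g (x ∷ xs) ys = begin
  sum (map h (map (g x) ys ++ rest))                       ≡⟨ cong sum (map-++ h (map (g x) ys) rest) ⟩
  sum (map h (map (g x) ys) ++ map h rest)                 ≡⟨ sum-++ (map h (map (g x) ys)) _ ⟩
  sum (map h (map (g x) ys)) + sum (map h rest)            ≡⟨ cong₂ _+_ (cong sum (sym (map-∘ ys))) (sum-cartesianProductWith h g xs ys) ⟩
  sum (map (h ∘ g x) ys) + sum (map (λ x′ → sum (map (λ y → h (g x′ y)) ys)) xs) ∎
  where
  open ≡-Reasoning
  rest = cartesianProductWith g xs ys

convolution : ℕ → ℕ → Vec ℕ N → ℕ
convolution x y α = sum (map (λ βγ → eCoeff x (proj₁ βγ) * eCoeff y (proj₂ βγ)) (splits α))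

-- Only splittings of the first exponent into parts of size at most 1 contribute: one for exponents
-- 0 and 2, two for exponent 1, none beyond.
convolution≡eeCoeff : ∀ x y (α : Vec ℕ N) → convolution x y α ≡ eeCoeff x y α
convolution≡eeCoeff zero    zero    [] = refl
convolution≡eeCoeff zero    (suc y) [] = refl
convolution≡eeCoeff (suc x) y       [] = refl
convolution≡eeCoeff x y (a ∷ α) =
  trans (sum-cartesianProductWith (λ βγ → eCoeff x (proj₁ βγ) * eCoeff y (proj₂ βγ)) _ (upTo (suc a)) (splits α)) (go a)
  where
  open ≡-Reasoning

  term : ℕ → ℕ → ℕ
  term a b = sum (map (λ βγ → eCoeff x (b ∷ proj₁ βγ) * eCoeff y ((a ∸ b) ∷ proj₂ βγ)) (splits α))

  term01 : term 1 0 ≡ ↓ (λ y′ → eeCoeff x y′ α) y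
  term01 = lem y
    where
    lem : ∀ y → sum (map (λ βγ → eCoeff x (proj₁ βγ) * ↓ (λ y′ → eCoeff y′ (proj₂ βγ)) y) (splits α))
              ≡ ↓ (λ y′ → eeCoeff x y′ α) y
    lem zero    = sum-zero (λ βγ → ℕ.*-zeroʳ (eCoeff x (proj₁ βγ))) (splits α)
    lem (suc y) = convolution≡eeCoeff x y α

  term11 : term 1 1 ≡ ↓ (λ x′ → eeCoeff x′ y α) x
  term11 = lem x
    where
    lem : ∀ x → sum (map (λ βγ → ↓ (λ x′ → eCoeff x′ (proj₁ βγ)) x * eCoeff y (proj₂ βγ)) (splits α))
              ≡ ↓ (λ x′ → eeCoeff x′ y α) x
    lem zero    = sum-zero (λ βγ → refl) (splits α)
    lem (suc x) = convolution≡eeCoeff x y α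

  term12 : term 2 1 ≡ ↓ (λ x′ → ↓ (λ y′ → eeCoeff x′ y′ α) y) x
  term12 = lem x y
    where
    lem : ∀ x y → sum (map (λ βγ → ↓ (λ x′ → eCoeff x′ (proj₁ βγ)) x * ↓ (λ y′ → eCoeff y′ (proj₂ βγ)) y) (splits α))
                ≡ ↓ (λ x′ → ↓ (λ y′ → eeCoeff x′ y′ α) y) x
    lem zero    y       = sum-zero (λ βγ → refl) (splits α)
    lem (suc x) zero    = sum-zero (λ βγ → ℕ.*-zeroʳ (eCoeff x (proj₁ βγ))) (splits α)
    lem (suc x) (suc y) = convolution≡eeCoeff x y α

  go : ∀ a → sum (map (term a) (upTo (suc a))) ≡ eeCoeff x y (a ∷ α)
  go 0 = trans (ℕ.+-identityʳ _) (convolution≡eeCoeff x y α)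
  go 1 = begin
    term 1 0 + (term 1 1 + 0)   ≡⟨ cong (term 1 0 +_) (ℕ.+-identityʳ _) ⟩
    term 1 0 + term 1 1         ≡⟨ ℕ.+-comm (term 1 0) _ ⟩
    term 1 1 + term 1 0         ≡⟨ cong₂ _+_ term11 term01 ⟩
    eeCoeff x y (1 ∷ α)         ∎
  go 2 = begin
    term 2 0 + (term 2 1 + (term 2 2 + 0))
      ≡⟨ cong₂ _+_ (sum-zero (λ βγ → ℕ.*-zeroʳ (eCoeff x (proj₁ βγ))) (splits α))
                   (cong (λ z → term 2 1 + (z + 0)) (sum-zero (λ βγ → refl) (splits α))) ⟩
    term 2 1 + 0                ≡⟨ ℕ.+-identityʳ _ ⟩
    term 2 1                    ≡⟨ term12 ⟩
    eeCoeff x y (2 ∷ α)         ∎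
  go (suc (suc (suc a))) = sum-zero vanish (upTo (4 + a))
    where
    vanish : ∀ b → term (3 + a) b ≡ 0
    vanish 0             = sum-zero (λ βγ → ℕ.*-zeroʳ (eCoeff x (proj₁ βγ))) (splits α)
    vanish 1             = sum-zero (λ βγ → ℕ.*-zeroʳ (eCoeff x (1 ∷ proj₁ βγ))) (splits α)
    vanish (suc (suc b)) = sum-zero (λ βγ → refl) (splits α)

-- Since e_0 = 1, the term ℓ = 0 may be read as e_n e_0 or as e_n; the expansion uses the first form
-- and e-positivity the second.
eeCoeff-0 : ∀ x (α : Vec ℕ N) → eeCoeff x 0 α ≡ eCoeff x α
eeCoeff-0 zero    []                = refl
eeCoeff-0 (suc x) []                = refl
eeCoeff-0 x       (0 ∷ α)           = eeCoeff-0 x α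
eeCoeff-0 zero    (1 ∷ α)           = refl
eeCoeff-0 (suc x) (1 ∷ α)           = trans (ℕ.+-identityʳ _) (eeCoeff-0 x α)
eeCoeff-0 zero    (2 ∷ α)           = refl
eeCoeff-0 (suc x) (2 ∷ α)           = refl
eeCoeff-0 x       (suc (suc (suc _)) ∷ α) = refl

*ₛ-const : ∀ (f g : Series) {h i : ∀ {N} → Vec ℕ N → ℕ} →
  (∀ {N} (α : Vec ℕ N) → f α ≈ₚ const (h α)) → (∀ {N} (α : Vec ℕ N) → g α ≈ₚ const (i α)) →
  ∀ {N} (α : Vec ℕ N) → (f *ₛ g) α ≈ₚ const (sum (map (λ βγ → h (proj₁ βγ) * i (proj₂ βγ)) (splits α)))
*ₛ-const f g f≈h g≈i α =
  const-∑ₚ (λ βγ → const-*ₚ {f (proj₁ βγ)} {g (proj₂ βγ)} (f≈h (proj₁ βγ)) (g≈i (proj₂ βγ))) (splits α)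

e[x]≈ : ∀ x {N} (α : Vec ℕ N) → e[ x ∷ [] ] α ≈ₚ const (eCoeff x α)
e[x]≈ x α = subst (λ k → e[ x ∷ [] ] α ≈ₚ const k) (trans (convolution≡eeCoeff x 0 α) (eeCoeff-0 x α))
  (*ₛ-const (e x) 1ₛ (e≈eCoeff x) 1ₛ≈eCoeff α)

e[x,y]≈ : ∀ x y {N} (α : Vec ℕ N) → e[ x ∷ y ∷ [] ] α ≈ₚ const (eeCoeff x y α)
e[x,y]≈ x y α = subst (λ k → e[ x ∷ y ∷ [] ] α ≈ₚ const k) (convolution≡eeCoeff x y α)
  (*ₛ-const (e x) e[ y ∷ [] ] (e≈eCoeff x) (e[x]≈ y) α)

-- The binomial coefficient "s choose a − b", which is 0 for a < b.
binom : ℕ → ℕ → ℕ → ℕ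
binom zero    zero    zero    = 1
binom zero    zero    (suc b) = 0
binom zero    (suc a) zero    = 0
binom zero    (suc a) (suc b) = binom zero a b
binom (suc s) a       b       = binom s a b + binom s a (suc b)

binom-suc : ∀ s a b → binom s (suc a) (suc b) ≡ binom s a b
binom-suc zero    a b = refl
binom-suc (suc s) a b = cong₂ _+_ (binom-suc s a b) (binom-suc s a (suc b))

binom-neg : ∀ s b → binom s 0 (suc b) ≡ 0
binom-neg zero    b = refl
binom-neg (suc s) b = cong₂ _+_ (binom-neg s b) (binom-neg s (suc b))

binom-big : ∀ s {a b} → s + b < a → binom s a b ≡ 0
binom-big zero    {suc a} {zero}  lt       = refl
binom-big zero    {suc a} {suc b} (s≤s lt) = binom-big zero lt
binom-big (suc s) {a}     {b}     lt       =
  cong₂ _+_ (binom-big s (ℕ.<-trans (ℕ.n<1+n _) lt)) (binom-big s (subst (_< a) (sym (ℕ.+-suc s b)) lt))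

-- `s` counts the exponents 1 and `q` the exponents 2. Vectors with a larger exponent have no
-- profile; for them both sides of the expansion vanish.
data Profile : Vec ℕ N → ℕ → ℕ → Set where
  []   : Profile [] 0 0
  0∷_  : ∀ {s q} {α : Vec ℕ N} → Profile α s q → Profile (0 ∷ α) s q
  1∷_  : ∀ {s q} {α : Vec ℕ N} → Profile α s q → Profile (1 ∷ α) (suc s) q
  2∷_  : ∀ {s q} {α : Vec ℕ N} → Profile α s q → Profile (2 ∷ α) s (suc q)

profile : (α : Vec ℕ N) → (∃₂ λ s q → Profile α s q) ⊎ VecAny.Any (3 ≤_) α
profile []      = inj₁ (_ , _ , [])
profile (0 ∷ α) with profile α
... | inj₁ (_ , _ , p) = inj₁ (_ , _ , 0∷ p)
... | inj₂ big         = inj₂ (there big)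
profile (1 ∷ α) with profile α
... | inj₁ (_ , _ , p) = inj₁ (_ , _ , 1∷ p)
... | inj₂ big         = inj₂ (there big)
profile (2 ∷ α) with profile α
... | inj₁ (_ , _ , p) = inj₁ (_ , _ , 2∷ p)
... | inj₂ big         = inj₂ (there big)
profile (suc (suc (suc a)) ∷ α) = inj₂ (here (s≤s (s≤s (s≤s z≤n))))

profile-sum : ∀ {α : Vec ℕ N} {s q} → Profile α s q → Vec.sum α ≡ s + 2 * q
profile-sum []             = refl
profile-sum (0∷ p)         = profile-sum p
profile-sum (1∷ p)         = cong suc (profile-sum p)
profile-sum {s = s} {suc q} (2∷ p) = trans (cong (2 +_) (profile-sum p))
  (solve 2 (λ s q → con 2 :+ (s :+ con 2 :* q) := s :+ con 2 :* (con 1 :+ q)) refl s q)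
  where open +-*-Solver

eeCoeff-sum : ∀ x y (α : Vec ℕ N) → x + y ≢ Vec.sum α → eeCoeff x y α ≡ 0
eeCoeff-sum zero    zero    []      ne = ⊥-elim (ne refl)
eeCoeff-sum zero    (suc y) []      ne = refl
eeCoeff-sum (suc x) y       []      ne = refl
eeCoeff-sum x       y       (0 ∷ α) ne = eeCoeff-sum x y α ne
eeCoeff-sum x       y       (1 ∷ α) ne = cong₂ _+_ (left x ne) (right y ne)
  where
  left : ∀ x → x + y ≢ suc (Vec.sum α) → ↓ (λ x′ → eeCoeff x′ y α) x ≡ 0
  left zero    ne = refl
  left (suc x) ne = eeCoeff-sum x y α (ne ∘ cong suc)
  right : ∀ y → x + y ≢ suc (Vec.sum α) → ↓ (λ y′ → eeCoeff x y′ α) y ≡ 0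
  right zero    ne = refl
  right (suc y) ne = eeCoeff-sum x y α (ne ∘ trans (ℕ.+-suc x y) ∘ cong suc)
eeCoeff-sum zero    y       (2 ∷ α) ne = refl
eeCoeff-sum (suc x) zero    (2 ∷ α) ne = refl
eeCoeff-sum (suc x) (suc y) (2 ∷ α) ne =
  eeCoeff-sum x y α (ne ∘ cong suc ∘ trans (ℕ.+-suc x y) ∘ cong suc)
eeCoeff-sum x       y       (suc (suc (suc _)) ∷ α) ne = refl

eeCoeff-big : ∀ x y {α : Vec ℕ N} → VecAny.Any (3 ≤_) α → eeCoeff x y α ≡ 0
eeCoeff-big x y {suc (suc (suc _)) ∷ α} big         = refl
eeCoeff-big x y {0 ∷ α} (there big) = eeCoeff-big x y big
eeCoeff-big x y {1 ∷ α} (there big) = cong₂ _+_ (left x) (right y)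
  where
  left : ∀ x → ↓ (λ x′ → eeCoeff x′ y α) x ≡ 0
  left zero    = refl
  left (suc x) = eeCoeff-big x y big
  right : ∀ y → ↓ (λ y′ → eeCoeff x y′ α) y ≡ 0
  right zero    = refl
  right (suc y) = eeCoeff-big x y big
eeCoeff-big zero    y       {2 ∷ α} (there big) = refl
eeCoeff-big (suc x) zero    {2 ∷ α} (there big) = refl
eeCoeff-big (suc x) (suc y) {2 ∷ α} (there big) = eeCoeff-big x y big
eeCoeff-big x y {0 ∷ α} (here ())
eeCoeff-big x y {1 ∷ α} (here (s≤s ()))
eeCoeff-big x y {2 ∷ α} (here (s≤s (s≤s ())))

-- Variables of exponent 2 go to both factors, so e_y has y - q places left for the s variables of
-- exponent 1; the degree condition makes e_x take exactly the remaining ones.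
eeCoeff≡binom : ∀ x y {α : Vec ℕ N} {s q} → Profile α s q → x + y ≡ Vec.sum α → eeCoeff x y α ≡ binom s y q
eeCoeff≡binom zero zero []     eq = refl
eeCoeff≡binom x    y    (0∷ p) eq = eeCoeff≡binom x y p eq
eeCoeff≡binom x    y    (1∷_ {s = s} {q} {α} p) eq = cong₂ _+_ (left x eq) (right y eq)
  where
  left : ∀ x → x + y ≡ suc (Vec.sum α) → ↓ (λ x′ → eeCoeff x′ y α) x ≡ binom s y q
  -- Here `y` is the whole degree 1 + s + 2q, so y - q exceeds s.
  left zero    eq = sym (binom-big s (ℕ.≤-trans (s≤s (ℕ.+-monoʳ-≤ s (ℕ.m≤m+n q _)))
    (ℕ.≤-reflexive (sym (trans eq (cong suc (profile-sum p)))))))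
  left (suc x) eq = eeCoeff≡binom x y p (ℕ.suc-injective eq)
  right : ∀ y → x + y ≡ suc (Vec.sum α) → ↓ (λ y′ → eeCoeff x y′ α) y ≡ binom s y (suc q)
  right zero    eq = sym (binom-neg s q)
  right (suc y) eq = trans (eeCoeff≡binom x y p (ℕ.suc-injective (trans (sym (ℕ.+-suc x y)) eq)))
                           (sym (binom-suc s y q))
eeCoeff≡binom zero    y       (2∷_ {s = s} {q} p) refl = sym (trans (binom-suc s _ q)
  (binom-big s (s≤s (ℕ.≤-trans (ℕ.+-monoʳ-≤ s (ℕ.m≤m+n q _)) (ℕ.≤-reflexive (sym (profile-sum p)))))))
eeCoeff≡binom (suc x) zero    (2∷_ {s = s} {q} p) eq = sym (binom-neg s q)
eeCoeff≡binom (suc x) (suc y) (2∷_ {s = s} {q} p) eq =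
  trans (eeCoeff≡binom x y p (ℕ.suc-injective (ℕ.suc-injective (trans (cong suc (sym (ℕ.+-suc x y))) eq))))
        (sym (binom-suc s y q))

-- Double sums

∑∑ : (A → B → ℕ) → List A → List B → ℕ
∑∑ f xs ys = sum (map (λ x → sum (map (f x) ys)) xs)

∑∑-++ˡ : ∀ (f : A → B → ℕ) xs xs′ ys → ∑∑ f (xs ++ xs′) ys ≡ ∑∑ f xs ys + ∑∑ f xs′ ys
∑∑-++ˡ f xs xs′ ys = trans (cong sum (map-++ _ xs xs′)) (sum-++ (map _ xs) _)

∑∑-∷ʳ : ∀ (f : A → B → ℕ) xs y ys → ∑∑ f xs (y ∷ ys) ≡ sum (map (λ x → f x y) xs) + ∑∑ f xs ys
∑∑-∷ʳ f []       y ys = refl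
∑∑-∷ʳ f (x ∷ xs) y ys = trans (cong (ℕ._+_ (f x y + sum (map (f x) ys))) (∑∑-∷ʳ f xs y ys))
  (solve 4 (λ a b c d → (a :+ b) :+ (c :+ d) := (a :+ c) :+ (b :+ d)) refl (f x y) _ _ _)
  where open +-*-Solver

∑∑-swap : ∀ (f : A → B → ℕ) xs ys → ∑∑ f xs ys ≡ ∑∑ (flip f) ys xs
∑∑-swap f xs []       = sum-zero (λ _ → refl) xs
∑∑-swap f xs (y ∷ ys) = trans (∑∑-∷ʳ f xs y ys) (cong (ℕ._+_ (sum (map (λ x → f x y) xs))) (∑∑-swap f xs ys))

∑∑-++ʳ : ∀ (f : A → B → ℕ) xs ys ys′ → ∑∑ f xs (ys ++ ys′) ≡ ∑∑ f xs ys + ∑∑ f xs ys′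
∑∑-++ʳ f xs ys ys′ = begin
  ∑∑ f xs (ys ++ ys′)                        ≡⟨ ∑∑-swap f xs (ys ++ ys′) ⟩
  ∑∑ (flip f) (ys ++ ys′) xs                 ≡⟨ ∑∑-++ˡ (flip f) ys ys′ xs ⟩
  ∑∑ (flip f) ys xs + ∑∑ (flip f) ys′ xs     ≡⟨ cong₂ _+_ (∑∑-swap f xs ys) (∑∑-swap f xs ys′) ⟨
  ∑∑ f xs ys + ∑∑ f xs ys′                   ∎
  where open ≡-Reasoning

∑∑-↭ˡ : ∀ (f : A → B → ℕ) {xs xs′} ys → xs ↭ xs′ → ∑∑ f xs ys ≡ ∑∑ f xs′ ys
∑∑-↭ˡ f ys p = sum-↭ (map⁺ _ p)

∑∑-↭ʳ : ∀ (f : A → B → ℕ) xs {ys ys′} → ys ↭ ys′ → ∑∑ f xs ys ≡ ∑∑ f xs ys′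
∑∑-↭ʳ f xs p = sum-cong (λ x → sum-↭ (map⁺ _ p)) xs

sum-cong-∈ : ∀ {f g : A → ℕ} xs → (∀ {x} → x ∈ xs → f x ≡ g x) → sum (map f xs) ≡ sum (map g xs)
sum-cong-∈ []       f≡g = refl
sum-cong-∈ (x ∷ xs) f≡g = cong₂ _+_ (f≡g (here refl)) (sum-cong-∈ xs (f≡g ∘ there))

∑∑-cong-∈ : ∀ {f g : A → B → ℕ} xs ys → (∀ {x y} → x ∈ xs → y ∈ ys → f x y ≡ g x y) →
  ∑∑ f xs ys ≡ ∑∑ g xs ys
∑∑-cong-∈ xs ys f≡g = sum-cong-∈ xs λ x∈ → sum-cong-∈ ys (f≡g x∈)

∑∑-zero : ∀ (xs : List A) (ys : List B) → ∑∑ (λ _ _ → 0) xs ys ≡ 0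
∑∑-zero xs ys = sum-zero (λ _ → sum-zero (λ _ → refl) ys) xs

indicator : {P : Set} → Dec P → ℕ
indicator P? = if does P? then 1 else 0

indicator-yes : {P : Set} (P? : Dec P) → P → indicator P? ≡ 1
indicator-yes (yes _) p = refl
indicator-yes (no ¬p) p = ⊥-elim (¬p p)

indicator-no : {P : Set} (P? : Dec P) → ¬ P → indicator P? ≡ 0
indicator-no (yes p) ¬p = ⊥-elim (¬p p)
indicator-no (no _)  ¬p = refl

indicator-⇔ : {P Q : Set} (P? : Dec P) (Q? : Dec Q) → (P → Q) → (Q → P) → indicator P? ≡ indicator Q?
indicator-⇔ (yes p) Q? P⇒Q Q⇒P = sym (indicator-yes Q? (P⇒Q p))
indicator-⇔ (no ¬p) Q? P⇒Q Q⇒P = sym (indicator-no Q? (¬p ∘ Q⇒P))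

length-filter² : {P Q : A → Set} (P? : U.Decidable P) (Q? : U.Decidable Q) → ∀ xs →
  length (filter Q? (filter P? xs)) ≡ sum (map (λ x → indicator (P? x ×-dec Q? x)) xs)
length-filter² P? Q? []       = refl
length-filter² P? Q? (x ∷ xs) with P? x
... | no _ = length-filter² P? Q? xs
... | yes _ with Q? x
...   | no _  = length-filter² P? Q? xs
...   | yes _ = cong suc (length-filter² P? Q? xs)

-- Words containing every element once, and enumeration of all fillings

EachOnce : List (Fin n) → Set
EachOnce xs = ∀ v → length (filter (v Fin.≟_) xs) ≡ 1

EachOnce-↭ : {xs ys : List (Fin n)} → xs ↭ ys → EachOnce xs → EachOnce ys
EachOnce-↭ p once v = trans (sym (↭-length (filter-↭ (v Fin.≟_) p))) (once v)

length-filter≟ : ∀ {xs : List (Fin n)} → Unique xs → ∀ {v} → v ∈ xs → length (filter (v Fin.≟_) xs) ≡ 1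
length-filter≟ {xs = xs} xs! {v} v∈ = ≅⇒length≡ id≅
  (record { unique   = Unique.filter⁺ (v Fin.≟_) xs!
          ; sound    = λ x∈ → proj₂ (∈-filter⁻ (v Fin.≟_) {xs = xs} x∈)
          ; complete = λ { refl → ∈-filter⁺ (v Fin.≟_) v∈ refl } })
  (record { unique = [] ∷ [] ; sound = λ { (here refl) → refl } ; complete = λ { refl → here refl } })
  where
  id≅ : (v ≡_) ≅ (v ≡_)
  id≅ = fromInverse id id (λ p → p , refl) (λ p → p , refl)

filter≟-∈ : ∀ {v} (xs : List (Fin n)) → 1 ≤ length (filter (v Fin.≟_) xs) → v ∈ xs
filter≟-∈ {v = v} (x ∷ xs) lt with v Fin.≟ x
... | yes refl = here refl
... | no _     = there (filter≟-∈ xs lt)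

filter≟-Unique : (xs : List (Fin n)) → (∀ v → length (filter (v Fin.≟_) xs) ≤ 1) → Unique xs
filter≟-Unique []       le = []
filter≟-Unique (x ∷ xs) le =
  All.tabulate (λ y∈ x≡y → fresh (subst (_∈ xs) (sym x≡y) y∈)) ∷ filter≟-Unique xs tail-le
  where
  fresh : ¬ x ∈ xs
  fresh x∈ with le x
  ... | le-x rewrite filter-accept (x Fin.≟_) {xs = xs} refl
      with filter (x Fin.≟_) xs | ∈-filter⁺ (x Fin.≟_) x∈ refl | le-x
  ...   | _ ∷ _ | _ | s≤s ()
  tail-le : ∀ v → length (filter (v Fin.≟_) xs) ≤ 1
  tail-le v with v Fin.≟ x | le v
  ... | yes refl | s≤s le-v = ℕ.≤-trans le-v z≤n
  ... | no _     | le-v     = le-v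

EachOnce⇒Unique : {xs : List (Fin n)} → EachOnce xs → Unique xs
EachOnce⇒Unique once = filter≟-Unique _ (ℕ.≤-reflexive ∘ once)

EachOnce⇒∈ : {xs : List (Fin n)} → EachOnce xs → ∀ v → v ∈ xs
EachOnce⇒∈ {xs = xs} once v = filter≟-∈ xs (ℕ.≤-reflexive (sym (once v)))

Unique∧∈⇒↭allFin : {xs : List (Fin n)} → Unique xs → (∀ v → v ∈ xs) → xs ↭ allFin n
Unique∧∈⇒↭allFin xs! ∈xs = ∼bag⇒↭ (unique∧set⇒bag xs! (Unique.allFin⁺ _) (mk⇔ (λ _ → ∈-allFin _) (λ _ → ∈xs _)))

EachOnce⇒↭ : {xs : List (Fin n)} → EachOnce xs → xs ↭ allFin n
EachOnce⇒↭ once = Unique∧∈⇒↭allFin (EachOnce⇒Unique once) (EachOnce⇒∈ once)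

enumerates-allFin : ∀ n → Enumerates {A = Fin n} (λ _ → ⊤) (allFin n)
enumerates-allFin n = record { unique = Unique.allFin⁺ n ; sound = λ _ → tt ; complete = λ _ → ∈-allFin _ }

enumerates-vectors : {xs : List A} → Enumerates (λ _ → ⊤) xs → ∀ k → Enumerates (λ _ → ⊤) (vectors xs k)
enumerates-vectors exs zero    =
  record { unique = [] ∷ [] ; sound = λ _ → tt ; complete = λ { {[]} _ → here refl } }
enumerates-vectors exs (suc k) = record
  { unique   = Unique.cartesianProductWith⁺ _∷_ Vec.∷-injective (unique exs) (unique vs)
  ; sound    = λ _ → tt
  ; complete = λ { {x ∷ v} _ → ∈-cartesianProductWith⁺ _∷_ (complete exs tt) (complete vs tt) }
  }
  where
  vs = enumerates-vectors exs k

enumerates-words : ∀ n k → Enumerates (λ w → length w ≡ k) (map toList (vectors (allFin n) k))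
enumerates-words n k = record
  { unique   = Unique.map⁺ (λ eq → trans (sym (Vec.cast-is-id refl _)) (Vec.toList-injective refl _ _ eq)) (unique vs)
  ; sound    = λ w∈ → let (v , _ , eq) = ∈-map⁻ toList w∈ in trans (cong length eq) (Vec.length-toList v)
  ; complete = λ { {w} refl → subst (_∈ map toList (vectors (allFin n) (length w))) (Vec.toList∘fromList w) (∈-map⁺ toList (complete vs tt)) }
  }
  where
  vs = enumerates-vectors (enumerates-allFin n) k

enumerates-fillings : ∀ n α → Enumerates (λ (T : Filling n) → map length T ≡ α) (fillings α)
enumerates-fillings n []      =
  record { unique = [] ∷ [] ; sound = λ { (here refl) → refl } ; complete = λ { {[]} _ → here refl } }
enumerates-fillings n (a ∷ α) = record
  { unique   = Unique.cartesianProductWith⁺ _∷_ ∷-injective (unique ws) (unique fs)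
  ; sound    = λ T∈ → let (_ , _ , R∈ , T′∈ , eq) = ∈-cartesianProductWith⁻ _∷_ _ _ T∈ in
                 trans (cong (map length) eq) (cong₂ _∷_ (sound ws R∈) (sound fs T′∈))
  ; complete = λ { {R ∷ T} eq → let (eq₁ , eq₂) = ∷-injective eq in
                 ∈-cartesianProductWith⁺ _∷_ (complete ws eq₁) (complete fs eq₂) }
  }
  where
  ws = enumerates-words n a
  fs = enumerates-fillings n α

-- Inversions of fillings and weight-preserving replacements

module Inversions {n : ℕ} (P : NaturalUnitIntervalOrder n) where
  open NaturalUnitIntervalOrder P

  _≺_ : Fin n → Fin n → Set
  _≺_ = _<P_ P

  _≺?_ : Decidable _≺_
  _≺?_ = _<P?_ P

  ≺⇒< : ∀ {a b} → a ≺ b → a Fin.< b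
  ≺⇒< (a<n , ma<b) = ℕ.≤-pred (ℕ.≤-<-trans (m-lower (s≤s z≤n) a<n) ma<b)

  ≺⇒¬edge : ∀ {a b} → a ≺ b → ¬ IncEdge P a b
  ≺⇒¬edge (_ , ma<b) (_ , b≤ma) = ℕ.<⇒≱ ma<b b≤ma

  ≺⇒¬edge˘ : ∀ {a b} → a ≺ b → ¬ IncEdge P b a
  ≺⇒¬edge˘ a≺b (b<a , _) = ℕ.<-asym b<a (≺⇒< a≺b)

  <∧⊀⇒edge : ∀ {a b} → a Fin.< b → ¬ a ≺ b → IncEdge P a b
  <∧⊀⇒edge {a} {b} a<b a⊀b =
    a<b , ℕ.≮⇒≥ λ ma<b → a⊀b (ℕ.<-≤-trans (s≤s a<b) (Fin.toℕ<n b) , ma<b)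

  -- By monotonicity of `m`, an x smaller than a would satisfy x ≺ b, and an x larger than b would
  -- satisfy a ≺ x. So x lies strictly between a and b and is joined to both.
  edge-between : ∀ {a b x} → a ≺ b → x ≢ a → x ≢ b → ¬ x ≺ b → ¬ a ≺ x → IncEdge P a x × IncEdge P x b
  edge-between {a} {b} {x} (a<n , ma<b) x≢a x≢b x⊀b a⊀x = a~x , x~b
    where
    a~x : IncEdge P a x
    a~x with Fin.<-cmp a x
    ... | tri< a<x _ _ = <∧⊀⇒edge a<x a⊀x
    ... | tri≈ _ a≡x _ = ⊥-elim (x≢a (sym a≡x))
    ... | tri> _ _ x<a = ⊥-elim (x⊀b (ℕ.<-trans (s≤s x<a) a<n ,
      ℕ.≤-<-trans (m-mono (s≤s z≤n) (ℕ.<⇒≤ (s≤s x<a)) a<n) ma<b))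
    x~b : IncEdge P x b
    x~b with Fin.<-cmp x b
    ... | tri< x<b _ _ = <∧⊀⇒edge x<b x⊀b
    ... | tri≈ _ x≡b _ = ⊥-elim (x≢b x≡b)
    ... | tri> _ _ b<x = ⊥-elim (a⊀x (a<n , ℕ.<-trans ma<b (s≤s b<x)))

  -- Whether u in a higher row than v is an inversion.
  cross : Fin n → Fin n → ℕ
  cross u v = indicator (incEdge? P v u)

  crossings : List (Fin n) → List (Fin n) → ℕ
  crossings = ∑∑ cross

  inversions : Filling n → ℕ
  inversions []      = 0
  inversions (R ∷ T) = crossings R (concat T) + inversions T

  -- For a relation u ⊏ v that reads "u is in a higher row of T than v".
  data Layered (_⊏_ : Fin n → Fin n → Set) : Filling n → Set where
    []  : Layered _⊏_ []
    _∷_ : ∀ {R T} →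
          (∀ {u v} → u ∈ R → v ∈ R → ¬ u ⊏ v)
          × (∀ {u v} → u ∈ R → v ∈ concat T → u ⊏ v × ¬ v ⊏ u) →
          Layered _⊏_ T → Layered _⊏_ (R ∷ T)

  module _ {_⊏_ : Fin n → Fin n → Set} (_⊏?_ : Decidable _⊏_) where

    edgeWeight : Fin n → Fin n → ℕ
    edgeWeight i j = indicator (incEdge? P i j ×-dec (j ⊏? i))

    ∑∑-edgeWeight : ∀ {T} → Layered _⊏_ T → ∑∑ edgeWeight (concat T) (concat T) ≡ inversions T
    ∑∑-edgeWeight []                        = refl
    ∑∑-edgeWeight {R ∷ T} ((same , lower) ∷ layered) = begin
      ∑∑ edgeWeight (R ++ V) (R ++ V)
        ≡⟨ ∑∑-++ˡ edgeWeight R V (R ++ V) ⟩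
      ∑∑ edgeWeight R (R ++ V) + ∑∑ edgeWeight V (R ++ V)
        ≡⟨ cong₂ _+_ (∑∑-++ʳ edgeWeight R R V) (∑∑-++ʳ edgeWeight V R V) ⟩
      (∑∑ edgeWeight R R + ∑∑ edgeWeight R V) + (∑∑ edgeWeight V R + ∑∑ edgeWeight V V)
        ≡⟨ cong₂ _+_ (cong₂ _+_ RR RV) (cong₂ _+_ VR (∑∑-edgeWeight layered)) ⟩
      crossings R V + inversions T
        ∎
      where
      open ≡-Reasoning
      V = concat T
      RR : ∑∑ edgeWeight R R ≡ 0
      RR = trans (∑∑-cong-∈ R R λ u∈ v∈ → indicator-no (incEdge? P _ _ ×-dec (_ ⊏? _)) (same v∈ u∈ ∘ proj₂))
                 (∑∑-zero R R)
      RV : ∑∑ edgeWeight R V ≡ 0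
      RV = trans (∑∑-cong-∈ R V λ u∈ v∈ → indicator-no (incEdge? P _ _ ×-dec (_ ⊏? _)) (proj₂ (lower u∈ v∈) ∘ proj₂))
                 (∑∑-zero R V)
      VR : ∑∑ edgeWeight V R ≡ crossings R V
      VR = trans (∑∑-cong-∈ V R λ v∈ u∈ → indicator-⇔ (incEdge? P _ _ ×-dec (_ ⊏? _)) (incEdge? P _ _)
                    proj₁ (_, proj₁ (lower u∈ v∈)))
                 (∑∑-swap (flip cross) V R)

    -- A common source for `inv` and `asc`: both count edges whose larger end is in a higher row,
    -- once rows are compared by index and once by colour. As a double sum over all vertices the
    -- count does not depend on the order in which they are listed, so `concat T` may replace
    -- `allFin n`.
    length-edges : ∀ {T} → Layered _⊏_ T → concat T ↭ allFin n →
      length (filter (λ ij → proj₂ ij ⊏? proj₁ ij) (edges (inc P))) ≡ inversions T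
    length-edges {T} layered p = begin
      length (filter (λ ij → proj₂ ij ⊏? proj₁ ij) (edges (inc P)))
        ≡⟨ length-filter² edge? _ (cartesianProduct (allFin n) (allFin n)) ⟩
      sum (map (λ ij → indicator (edge? ij ×-dec (proj₂ ij ⊏? proj₁ ij))) (cartesianProduct (allFin n) (allFin n)))
        ≡⟨ sum-cong (λ (i , j) → indicator-⇔ (edge? (i , j) ×-dec (j ⊏? i)) (incEdge? P i j ×-dec (j ⊏? i))
             (λ { ((_ , inj₁ e) , j⊏i) → e , j⊏i
                ; ((i<j , inj₂ (j<i , _)) , j⊏i) → ⊥-elim (ℕ.<-asym i<j j<i) })
             (λ (e , j⊏i) → (proj₁ e , inj₁ e) , j⊏i)) (cartesianProduct (allFin n) (allFin n)) ⟩
      sum (map (λ ij → edgeWeight (proj₁ ij) (proj₂ ij)) (cartesianProduct (allFin n) (allFin n)))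
        ≡⟨ sum-cartesianProductWith (λ ij → edgeWeight (proj₁ ij) (proj₂ ij)) _,_ (allFin n) (allFin n) ⟩
      ∑∑ edgeWeight (allFin n) (allFin n)
        ≡⟨ ∑∑-↭ˡ edgeWeight (allFin n) p ⟨
      ∑∑ edgeWeight (concat T) (allFin n)
        ≡⟨ ∑∑-↭ʳ edgeWeight (concat T) p ⟨
      ∑∑ edgeWeight (concat T) (concat T)
        ≡⟨ ∑∑-edgeWeight layered ⟩
      inversions T
        ∎
      where
      open ≡-Reasoning
      edge? : (ij : Fin n × Fin n) → Dec (proj₁ ij Fin.< proj₂ ij × Graph.Adj (inc P) (proj₁ ij) (proj₂ ij))
      edge? (i , j) = (i Fin.<? j) ×-dec Graph.adj? (inc P) i j

  infix 4 _≃_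
  -- Exactly what is required to carry the fields `once` and `weight` of an `Arrangement` from one
  -- filling to another.
  record _≃_ (T T′ : Filling n) : Set where
    constructor mk≃
    field
      same-content    : concat T ↭ concat T′
      same-inversions : inversions T ≡ inversions T′

  open _≃_ public

  ≃-refl : ∀ {T} → T ≃ T
  ≃-refl = mk≃ ↭-refl refl

  ≃-sym : ∀ {T T′} → T ≃ T′ → T′ ≃ T
  ≃-sym (mk≃ p eq) = mk≃ (↭-sym p) (sym eq)

  ≃-trans : ∀ {T T′ T″} → T ≃ T′ → T′ ≃ T″ → T ≃ T″
  ≃-trans (mk≃ p eq) (mk≃ p′ eq′) = mk≃ (↭-trans p p′) (trans eq eq′)

  ∷-≃ : ∀ R {T T′} → T ≃ T′ → R ∷ T ≃ R ∷ T′
  ∷-≃ R (mk≃ p eq) = mk≃ (++⁺ˡ R p) (cong₂ _+_ (∑∑-↭ʳ cross R p) eq)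

  ʳ++-≃ : ∀ U {T T′} → T ≃ T′ → U ʳ++ T ≃ U ʳ++ T′
  ʳ++-≃ []      T≃T′ = T≃T′
  ʳ++-≃ (R ∷ U) T≃T′ = ʳ++-≃ U (∷-≃ R T≃T′)

  -- Pairs within one row are never inversions, so merging loses only those between `R` and `S`, of
  -- which there are none.
  merge-≃ : ∀ R S T → crossings R S ≡ 0 → R ∷ S ∷ T ≃ (R ++ S) ∷ T
  merge-≃ R S T eq = mk≃ (↭-reflexive (sym (++-assoc R S (concat T)))) (begin
    crossings R (S ++ V) + (crossings S V + inversions T)
      ≡⟨ cong (_+ (crossings S V + inversions T)) (∑∑-++ʳ cross R S V) ⟩
    (crossings R S + crossings R V) + (crossings S V + inversions T)
      ≡⟨ cong (λ k → (k + crossings R V) + (crossings S V + inversions T)) eq ⟩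
    crossings R V + (crossings S V + inversions T)
      ≡⟨ ℕ.+-assoc (crossings R V) _ _ ⟨
    crossings R V + crossings S V + inversions T
      ≡⟨ cong (_+ inversions T) (∑∑-++ˡ cross R S V) ⟨
    crossings (R ++ S) V + inversions T
      ∎)
    where
    open ≡-Reasoning
    V = concat T

  -- Only the inversions between the two rows depend on how their elements are distributed.
  rows-≃ : ∀ R S R′ S′ T → R ++ S ↭ R′ ++ S′ → crossings R S ≡ crossings R′ S′ → R ∷ S ∷ T ≃ R′ ∷ S′ ∷ T
  rows-≃ R S R′ S′ T p eq =
    mk≃ (↭-trans (↭-reflexive (sym (++-assoc R S V))) (↭-trans (++⁺ʳ V p) (↭-reflexive (++-assoc R′ S′ V)))) (begin
    inversions (R ∷ S ∷ T)                                      ≡⟨ expand R S ⟩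
    crossings R S + (crossings (R ++ S) V + inversions T)       ≡⟨ cong₂ _+_ eq (cong (_+ inversions T) (∑∑-↭ˡ cross V p)) ⟩
    crossings R′ S′ + (crossings (R′ ++ S′) V + inversions T)   ≡⟨ expand R′ S′ ⟨
    inversions (R′ ∷ S′ ∷ T)                                    ∎)
    where
    open ≡-Reasoning
    V = concat T
    expand : ∀ R S → inversions (R ∷ S ∷ T) ≡ crossings R S + (crossings (R ++ S) V + inversions T)
    expand R S = begin
      crossings R (S ++ V) + (crossings S V + inversions T)
        ≡⟨ cong (_+ (crossings S V + inversions T)) (∑∑-++ʳ cross R S V) ⟩
      (crossings R S + crossings R V) + (crossings S V + inversions T)
        ≡⟨ solve 4 (λ a b c d → (a :+ b) :+ (c :+ d) := a :+ ((b :+ c) :+ d)) refl (crossings R S) (crossings R V) _ _ ⟩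
      crossings R S + ((crossings R V + crossings S V) + inversions T)
        ≡⟨ cong (λ k → crossings R S + (k + inversions T)) (∑∑-++ˡ cross R S V) ⟨
      crossings R S + (crossings (R ++ S) V + inversions T)
        ∎
      where open +-*-Solver

  ≺⇒cross≡0 : ∀ {a b} → a ≺ b → cross a b ≡ 0
  ≺⇒cross≡0 a≺b = indicator-no (incEdge? P _ _) (≺⇒¬edge˘ a≺b)

  ≺⇒cross˘≡0 : ∀ {a b} → a ≺ b → cross b a ≡ 0
  ≺⇒cross˘≡0 a≺b = indicator-no (incEdge? P _ _) (≺⇒¬edge a≺b)

  edge⇒cross≡0 : ∀ {a b} → IncEdge P a b → cross a b ≡ 0
  edge⇒cross≡0 (a<b , _) = indicator-no (incEdge? P _ _) λ (b<a , _) → ℕ.<-asym a<b b<a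

  edge⇒cross˘≡1 : ∀ {a b} → IncEdge P a b → cross b a ≡ 1
  edge⇒cross˘≡1 e = indicator-yes (incEdge? P _ _) e

enumerates-⇔ : {P Q : A → Set} {xs : List A} → (∀ {x} → P x → Q x) → (∀ {x} → Q x → P x) →
  Enumerates P xs → Enumerates Q xs
enumerates-⇔ P⇒Q Q⇒P exs =
  record { unique = unique exs ; sound = P⇒Q ∘ sound exs ; complete = complete exs ∘ Q⇒P }

enumerates-∅ : {P : A → Set} {xs : List A} → (∀ {x} → ¬ P x) → Enumerates P xs → length xs ≡ 0
enumerates-∅ {xs = []}     ¬P exs = refl
enumerates-∅ {xs = x ∷ xs} ¬P exs = ⊥-elim (¬P (Enumerates.sound exs (here refl)))

length-concat : (T : List (List A)) → length (concat T) ≡ sum (map length T)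
length-concat []      = refl
length-concat (R ∷ T) = trans (length-++ R) (cong (length R +_) (length-concat T))

sum-map-ʳ++ : ∀ (f : A → ℕ) xs ys → sum (map f (xs ʳ++ ys)) ≡ sum (map f xs) + sum (map f ys)
sum-map-ʳ++ f []       ys = refl
sum-map-ʳ++ f (x ∷ xs) ys = begin
  sum (map f (xs ʳ++ x ∷ ys))                  ≡⟨ sum-map-ʳ++ f xs (x ∷ ys) ⟩
  sum (map f xs) + (f x + sum (map f ys))      ≡⟨ ℕ.+-assoc (sum (map f xs)) (f x) _ ⟨
  (sum (map f xs) + f x) + sum (map f ys)      ≡⟨ cong (_+ sum (map f ys)) (ℕ.+-comm (sum (map f xs)) (f x)) ⟩
  (f x + sum (map f xs)) + sum (map f ys)      ∎
  where open ≡-Reasoning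

concat-map-[] : (w : List A) → concat (map [_] w) ≡ w
concat-map-[] []      = refl
concat-map-[] (x ∷ w) = cong (x ∷_) (concat-map-[] w)

-- Arrangements: chain rows above a descent-free column

module Arrangements {n : ℕ} (P : NaturalUnitIntervalOrder n)
    (no-chain : ∀ {a b c} → _<P_ P a b → _<P_ P b c → ⊥) where
  open Inversions P

  pair-≃ : ∀ {a b} T → a ≺ b → [ a ] ∷ [ b ] ∷ T ≃ (a ∷ b ∷ []) ∷ T
  pair-≃ T a≺b = merge-≃ [ _ ] [ _ ] T (cong (λ k → k + 0 + 0) (≺⇒cross≡0 a≺b))

  flip-≃ : ∀ {a b} T → a ≺ b → [ b ] ∷ [ a ] ∷ T ≃ [ a ] ∷ [ b ] ∷ T
  flip-≃ T a≺b = rows-≃ [ _ ] [ _ ] [ _ ] [ _ ] T (swap _ _ refl)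
    (cong (λ k → k + 0 + 0) (trans (≺⇒cross˘≡0 a≺b) (sym (≺⇒cross≡0 a≺b))))

  Word : Set
  Word = List (Fin n)

  NoDescent : Word → Set
  NoDescent = Linked (λ x y → ¬ y ≺ x)

  -- U lists the upper rows of a filling from bottom to top, and w
  -- the rows of length 1 below them from top to bottom.
  filling : Filling n × Word → Filling n
  filling (U , w) = U ʳ++ map [_] w

  -- The objects counted by Y(α | p), of weight `d`. As the upper rows are stored from bottom to
  -- top, the head of `α` belongs to the row next to the column. No column condition is imposed
  -- among the upper rows or between them and the word.
  record Arrangement (α : List ℕ) (p d : ℕ) (x : Filling n × Word) : Set where
    constructor arr
    field
      shape     : map length (proj₁ x) ≡ α
      size      : length (proj₂ x) ≡ p
      once      : EachOnce (concat (filling x))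
      chains    : All (Linked _≺_) (proj₁ x)
      noDescent : NoDescent (proj₂ x)
      weight    : inversions (filling x) ≡ d

  Good : ℕ → Filling n × Word → Set
  Good d x = EachOnce (concat (filling x)) × All (Linked _≺_) (proj₁ x)
           × NoDescent (proj₂ x) × inversions (filling x) ≡ d

  good? : ∀ d → U.Decidable (Good d)
  good? d x = Fin.all? (λ v → length (filter (v Fin.≟_) (concat (filling x))) ℕ.≟ 1)
    ×-dec All.all? (linked? _≺?_) (proj₁ x)
    ×-dec linked? (λ x y → ¬? (y ≺? x)) (proj₂ x)
    ×-dec (inversions (filling x) ℕ.≟ d)

  arrangements : List ℕ → ℕ → ℕ → List (Filling n × Word)
  arrangements α p d = filter (good? d) (cartesianProduct (fillings α) (map toList (vectors (allFin n) p)))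

  enumerates-arrangements : ∀ α p d → Enumerates (Arrangement α p d) (arrangements α p d)
  enumerates-arrangements α p d = enumerates-⇔
    (λ { ((s , l) , o , c , nd , w) → arr s l o c nd w }) (λ { (arr s l o c nd w) → (s , l) , o , c , nd , w })
    (enumerates-filter (good? d) (record
      { unique   = Unique.cartesianProduct⁺ (unique fs) (unique ws)
      ; sound    = λ x∈ → let (U∈ , w∈) = ∈-cartesianProduct⁻ _ _ x∈ in sound fs U∈ , sound ws w∈
      ; complete = λ (s , l) → ∈-cartesianProduct⁺ (complete fs s) (complete ws l)
      }))
    where
    fs = enumerates-fillings n α
    ws = enumerates-words n p

  count : List ℕ → ℕ → ℕ → ℕ
  count α p d = length (arrangements α p d)

  count-≅ : ∀ {α p α′ p′ d} → Arrangement α p d ≅ Arrangement α′ p′ d → count α p d ≡ count α′ p′ d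
  count-≅ f = ≅⇒length≡ f (enumerates-arrangements _ _ _) (enumerates-arrangements _ _ _)

  -- Bender–Knuth involution on two adjacent rows X, Y: exchange the colours on those components of the
  -- graph induced on X ∪ Y that have an odd number of vertices.
  exchange : Word → Word → Word × Word
  exchange []           Y            = Y , []
  exchange (x ∷ X)      []           = [] , x ∷ X
  exchange (x ∷ [])     (y ∷ [])     = [ x ] , [ y ]
  exchange (x ∷ [])     (a ∷ b ∷ []) with x ≺? b | a ≺? x
  ... | yes _ | _     = x ∷ b ∷ [] , [ a ]
  ... | no _  | yes _ = a ∷ x ∷ [] , [ b ]
  ... | no _  | no _  = a ∷ b ∷ [] , [ x ]
  exchange (a ∷ b ∷ []) (x ∷ [])     with x ≺? b | a ≺? x
  ... | yes _ | _     = [ a ] , x ∷ b ∷ []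
  ... | no _  | yes _ = [ b ] , a ∷ x ∷ []
  ... | no _  | no _  = [ x ] , a ∷ b ∷ []
  exchange X            Y            = X , Y

  record Exchanged (X Y : Word) (X′Y′ : Word × Word) : Set where
    constructor exch
    field
      lengthˡ    : length (proj₁ X′Y′) ≡ length Y
      lengthʳ    : length (proj₂ X′Y′) ≡ length X
      chainˡ     : Linked _≺_ (proj₁ X′Y′)
      chainʳ     : Linked _≺_ (proj₂ X′Y′)
      equivalent : ∀ T → X ∷ Y ∷ T ≃ proj₁ X′Y′ ∷ proj₂ X′Y′ ∷ T
      involutive : exchange (proj₁ X′Y′) (proj₂ X′Y′) ≡ (X , Y)

  -- The substantial case is a letter x against a row a ≺ b. If x ≺ b, then b is joined to neither a
  -- nor x and changes rows alone; if a ≺ x, the same holds for a. Otherwise `edge-between` joins x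
  -- to both, all three letters change rows, and x makes one inversion with the chain from either
  -- side. Rows of equal length are left as they are, since their lengths need no exchange.
  exchange✓ : ∀ X Y → Linked _≺_ X → Linked _≺_ Y → Exchanged X Y (exchange X Y)
  exchange✓ []           []           lX lY = exch refl refl lY [] (λ T → ≃-refl) refl
  exchange✓ []           (y ∷ Y)      lX lY = exch refl refl lY []
    (λ T → rows-≃ [] (y ∷ Y) (y ∷ Y) [] T (↭-reflexive (sym (++-identityʳ _))) (sym (∑∑-swap cross (y ∷ Y) []))) refl
  exchange✓ (x ∷ X)      []           lX lY = exch refl refl [] lX
    (λ T → rows-≃ (x ∷ X) [] [] (x ∷ X) T (↭-reflexive (++-identityʳ _)) (∑∑-swap cross (x ∷ X) [])) refl
  exchange✓ (x ∷ [])     (y ∷ [])     lX lY = exch refl refl [-] [-] (λ T → ≃-refl) refl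
  exchange✓ (x ∷ [])     (a ∷ b ∷ []) lX (a≺b ∷ [-]) with x ≺? b | a ≺? x
  ... | yes x≺b | _       = exch refl refl (x≺b ∷ [-]) [-]
    (λ T → rows-≃ [ x ] (a ∷ b ∷ []) (x ∷ b ∷ []) [ a ] T (prep x (swap a b refl)) weights) back
    where
    weights : crossings [ x ] (a ∷ b ∷ []) ≡ crossings (x ∷ b ∷ []) [ a ]
    weights rewrite ≺⇒cross≡0 x≺b | ≺⇒cross˘≡0 a≺b = refl
    back : exchange (x ∷ b ∷ []) [ a ] ≡ ([ x ] , a ∷ b ∷ [])
    back with a ≺? b | x ≺? a
    ... | yes _   | _ = refl
    ... | no a⊀b | _ = ⊥-elim (a⊀b a≺b)
  ... | no x⊀b  | yes a≺x = exch refl refl (a≺x ∷ [-]) [-]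
    (λ T → rows-≃ [ x ] (a ∷ b ∷ []) (a ∷ x ∷ []) [ b ] T (swap x a refl) weights) back
    where
    weights : crossings [ x ] (a ∷ b ∷ []) ≡ crossings (a ∷ x ∷ []) [ b ]
    weights rewrite ≺⇒cross˘≡0 a≺x | ≺⇒cross≡0 a≺b = refl
    back : exchange (a ∷ x ∷ []) [ b ] ≡ ([ x ] , a ∷ b ∷ [])
    back with b ≺? x | a ≺? b
    ... | yes b≺x | _       = ⊥-elim (no-chain a≺b b≺x)
    ... | no _    | yes _   = refl
    ... | no _    | no a⊀b = ⊥-elim (a⊀b a≺b)
  ... | no x⊀b  | no a⊀x  = exch refl refl (a≺b ∷ [-]) [-]
    (λ T → rows-≃ [ x ] (a ∷ b ∷ []) (a ∷ b ∷ []) [ x ] T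
             (↭-trans (swap x a refl) (prep a (swap x b refl))) weights) back
    where
    between = edge-between a≺b (λ { refl → x⊀b a≺b }) (λ { refl → a⊀x a≺b }) x⊀b a⊀x
    a~x = proj₁ between
    x~b = proj₂ between
    weights : crossings [ x ] (a ∷ b ∷ []) ≡ crossings (a ∷ b ∷ []) [ x ]
    weights rewrite edge⇒cross≡0 a~x | edge⇒cross˘≡1 a~x | edge⇒cross≡0 x~b | edge⇒cross˘≡1 x~b = refl
    back : exchange (a ∷ b ∷ []) [ x ] ≡ ([ x ] , a ∷ b ∷ [])
    back with x ≺? b | a ≺? x
    ... | yes x≺b | _       = ⊥-elim (x⊀b x≺b)
    ... | no _    | yes a≺x = ⊥-elim (a⊀x a≺x)
    ... | no _    | no _    = refl
  exchange✓ (a ∷ b ∷ []) (x ∷ [])     (a≺b ∷ [-]) lY with x ≺? b | a ≺? x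
  ... | yes x≺b | _       = exch refl refl [-] (x≺b ∷ [-])
    (λ T → rows-≃ (a ∷ b ∷ []) [ x ] [ a ] (x ∷ b ∷ []) T (prep a (swap b x refl)) weights) back
    where
    weights : crossings (a ∷ b ∷ []) [ x ] ≡ crossings [ a ] (x ∷ b ∷ [])
    weights rewrite ≺⇒cross˘≡0 x≺b | ≺⇒cross≡0 a≺b = refl
    back : exchange [ a ] (x ∷ b ∷ []) ≡ (a ∷ b ∷ [] , [ x ])
    back with a ≺? b | x ≺? a
    ... | yes _   | _ = refl
    ... | no a⊀b | _ = ⊥-elim (a⊀b a≺b)
  ... | no x⊀b  | yes a≺x = exch refl refl [-] (a≺x ∷ [-])
    (λ T → rows-≃ (a ∷ b ∷ []) [ x ] [ b ] (a ∷ x ∷ []) T (swap a b refl) weights) back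
    where
    weights : crossings (a ∷ b ∷ []) [ x ] ≡ crossings [ b ] (a ∷ x ∷ [])
    weights rewrite ≺⇒cross≡0 a≺x | ≺⇒cross˘≡0 a≺b = refl
    back : exchange [ b ] (a ∷ x ∷ []) ≡ (a ∷ b ∷ [] , [ x ])
    back with b ≺? x | a ≺? b
    ... | yes b≺x | _       = ⊥-elim (no-chain a≺b b≺x)
    ... | no _    | yes _   = refl
    ... | no _    | no a⊀b = ⊥-elim (a⊀b a≺b)
  ... | no x⊀b  | no a⊀x  = exch refl refl [-] (a≺b ∷ [-])
    (λ T → rows-≃ (a ∷ b ∷ []) [ x ] [ x ] (a ∷ b ∷ []) T
             (↭-trans (prep a (swap b x refl)) (swap a x refl)) weights) back
    where
    between = edge-between a≺b (λ { refl → x⊀b a≺b }) (λ { refl → a⊀x a≺b }) x⊀b a⊀x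
    a~x = proj₁ between
    x~b = proj₂ between
    weights : crossings (a ∷ b ∷ []) [ x ] ≡ crossings [ x ] (a ∷ b ∷ [])
    weights rewrite edge⇒cross≡0 a~x | edge⇒cross˘≡1 a~x | edge⇒cross≡0 x~b | edge⇒cross˘≡1 x~b = refl
    back : exchange [ x ] (a ∷ b ∷ []) ≡ (a ∷ b ∷ [] , [ x ])
    back with x ≺? b | a ≺? x
    ... | yes x≺b | _       = ⊥-elim (x⊀b x≺b)
    ... | no _    | yes a≺x = ⊥-elim (a⊀x a≺x)
    ... | no _    | no _    = refl
  exchange✓ (a ∷ b ∷ []) (c ∷ e ∷ []) lX lY = exch refl refl lX lY (λ T → ≃-refl) refl
  exchange✓ (_ ∷ [])     (_ ∷ _ ∷ _ ∷ _) lX (p ∷ q ∷ _) = ⊥-elim (no-chain p q)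
  exchange✓ (_ ∷ _ ∷ []) (_ ∷ _ ∷ _ ∷ _) lX (p ∷ q ∷ _) = ⊥-elim (no-chain p q)
  exchange✓ (_ ∷ _ ∷ _ ∷ _) (_ ∷ _)      (p ∷ q ∷ _) lY = ⊥-elim (no-chain p q)

  -- Of two neighbours `Y ∷ X` in the stored order, `X` is the upper row, so it is the first
  -- argument of `exchange`.
  exchangeAt : ℕ → Filling n → Filling n
  exchangeAt zero    (Y ∷ X ∷ U) = proj₂ (exchange X Y) ∷ proj₁ (exchange X Y) ∷ U
  exchangeAt (suc k) (Y ∷ U)     = Y ∷ exchangeAt k U
  exchangeAt _       U           = U

  exchangeAt-shape : ∀ β a b γ {U} → All (Linked _≺_) U → map length U ≡ β ++ a ∷ b ∷ γ →
    map length (exchangeAt (length β) U) ≡ β ++ b ∷ a ∷ γ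
  exchangeAt-shape []      a b γ {Y ∷ X ∷ U} (lY ∷ lX ∷ _) refl =
    cong₂ (λ k l → k ∷ l ∷ map length U) lengthʳ lengthˡ
    where open Exchanged (exchange✓ X Y lX lY)
  exchangeAt-shape (c ∷ β) a b γ {Y ∷ U} (_ ∷ lU) eq =
    cong₂ _∷_ (∷-injectiveˡ eq) (exchangeAt-shape β a b γ lU (∷-injectiveʳ eq))

  exchangeAt-chains : ∀ k {U} → All (Linked _≺_) U → All (Linked _≺_) (exchangeAt k U)
  exchangeAt-chains zero    {[]}        ls             = ls
  exchangeAt-chains zero    {_ ∷ []}    ls             = ls
  exchangeAt-chains zero    {Y ∷ X ∷ U} (lY ∷ lX ∷ ls) = chainʳ ∷ chainˡ ∷ ls
    where open Exchanged (exchange✓ X Y lX lY)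
  exchangeAt-chains (suc k) {[]}        ls             = ls
  exchangeAt-chains (suc k) {Y ∷ U}     (lY ∷ ls)      = lY ∷ exchangeAt-chains k ls

  exchangeAt-≃ : ∀ k {U} T → All (Linked _≺_) U → U ʳ++ T ≃ exchangeAt k U ʳ++ T
  exchangeAt-≃ zero    {[]}        T ls             = ≃-refl
  exchangeAt-≃ zero    {_ ∷ []}    T ls             = ≃-refl
  exchangeAt-≃ zero    {Y ∷ X ∷ U} T (lY ∷ lX ∷ ls) = ʳ++-≃ U (equivalent T)
    where open Exchanged (exchange✓ X Y lX lY)
  exchangeAt-≃ (suc k) {[]}        T ls             = ≃-refl
  exchangeAt-≃ (suc k) {Y ∷ U}     T (lY ∷ ls)      = exchangeAt-≃ k (Y ∷ T) ls

  exchangeAt-involutive : ∀ k {U} → All (Linked _≺_) U → exchangeAt k (exchangeAt k U) ≡ U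
  exchangeAt-involutive zero    {[]}        ls             = refl
  exchangeAt-involutive zero    {_ ∷ []}    ls             = refl
  exchangeAt-involutive zero    {Y ∷ X ∷ U} (lY ∷ lX ∷ ls) =
    cong (λ XY → proj₂ XY ∷ proj₁ XY ∷ U) involutive
    where open Exchanged (exchange✓ X Y lX lY)
  exchangeAt-involutive (suc k) {[]}        ls             = refl
  exchangeAt-involutive (suc k) {Y ∷ U}     (lY ∷ ls)      = cong (Y ∷_) (exchangeAt-involutive k ls)

  once-≃ : ∀ {T T′} → T ≃ T′ → EachOnce (concat T) → EachOnce (concat T′)
  once-≃ T≃T′ = EachOnce-↭ (same-content T≃T′)

  weight-≃ : ∀ {T T′ d} → T ≃ T′ → inversions T ≡ d → inversions T′ ≡ d
  weight-≃ T≃T′ = trans (sym (same-inversions T≃T′))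

  exchange-≅ : ∀ β a b γ {p d} → Arrangement (β ++ a ∷ b ∷ γ) p d ≅ Arrangement (β ++ b ∷ a ∷ γ) p d
  exchange-≅ β a b γ {p} {d} = fromInverse step step (step✓ a b) (step✓ b a)
    where
    step : Filling n × Word → Filling n × Word
    step (U , w) = exchangeAt (length β) U , w
    step✓ : ∀ a b {x} → Arrangement (β ++ a ∷ b ∷ γ) p d x →
      Arrangement (β ++ b ∷ a ∷ γ) p d (step x) × step (step x) ≡ x
    step✓ a b {U , w} (arr s l o c nd wt) =
      arr (exchangeAt-shape β a b γ c s) l (once-≃ same o) (exchangeAt-chains (length β) c) nd (weight-≃ same wt)
      , cong (_, w) (exchangeAt-involutive (length β) c)
      where same = exchangeAt-≃ (length β) (map [_] w) c

  -- The prefix `β` holds the rows already passed by the induction on the permutation; a swap behind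
  -- it is the exchange at position `length β`.
  count-++-↭ : ∀ β {α α′} → α ↭ α′ → ∀ p d → count (β ++ α) p d ≡ count (β ++ α′) p d
  count-++-↭ β refl p d = refl
  count-++-↭ β (prep {xs} {ys} a q) p d =
    subst₂ (λ γ δ → count γ p d ≡ count δ p d) (++-assoc β [ a ] xs) (++-assoc β [ a ] ys)
      (count-++-↭ (β ++ [ a ]) q p d)
  count-++-↭ β (swap {xs} {ys} a b q) p d = trans (count-≅ (exchange-≅ β a b xs))
    (subst₂ (λ γ δ → count γ p d ≡ count δ p d) (++-assoc β (b ∷ a ∷ []) xs) (++-assoc β (b ∷ a ∷ []) ys)
      (count-++-↭ (β ++ b ∷ a ∷ []) q p d))
  count-++-↭ β (↭.trans q r) p d = trans (count-++-↭ β q p d) (count-++-↭ β r p d)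

  count-↭ : ∀ {α α′} → α ↭ α′ → ∀ p d → count α p d ≡ count α′ p d
  count-↭ = count-++-↭ []

  drop-empty-≅ : ∀ {β p d} → Arrangement (0 ∷ β) p d ≅ Arrangement β p d
  drop-empty-≅ {β} {p} {d} = fromInverse to from to✓ from✓
    where
    to from : Filling n × Word → Filling n × Word
    to (U , w)   = List.drop 1 U , w
    from (U , w) = [] ∷ U , w
    same : ∀ U w → filling ([] ∷ U , w) ≃ filling (U , w)
    same U w = ʳ++-≃ U (mk≃ ↭-refl refl)
    to✓ : ∀ {x} → Arrangement (0 ∷ β) p d x → Arrangement β p d (to x) × from (to x) ≡ x
    to✓ {[] ∷ U , w} (arr s l o (_ ∷ c) nd wt) =
      arr (∷-injectiveʳ s) l (once-≃ (same U w) o) c nd (weight-≃ (same U w) wt) , refl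
    from✓ : ∀ {x} → Arrangement β p d x → Arrangement (0 ∷ β) p d (from x) × to (from x) ≡ x
    from✓ {U , w} (arr s l o c nd wt) =
      arr (cong (0 ∷_) s) l (once-≃ (≃-sym (same U w)) o) ([] ∷ c) nd (weight-≃ (≃-sym (same U w)) wt) , refl

  last-single-≅ : ∀ {β d} → Arrangement (1 ∷ β) 0 d ≅ Arrangement β 1 d
  last-single-≅ {β} {d} = fromInverse to from to✓ from✓
    where
    to from : Filling n × Word → Filling n × Word
    to (R ∷ U , _)     = U , R
    to ([] , w)        = [] , w
    from (U , w)       = w ∷ U , []
    to✓ : ∀ {x} → Arrangement (1 ∷ β) 0 d x → Arrangement β 1 d (to x) × from (to x) ≡ x
    to✓ {(x ∷ []) ∷ U , []} (arr s l o (_ ∷ c) nd wt) = arr (∷-injectiveʳ s) refl o c [-] wt , refl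
    from✓ : ∀ {x} → Arrangement β 1 d x → Arrangement (1 ∷ β) 0 d (from x) × to (from x) ≡ x
    from✓ {U , x ∷ []} (arr s l o c nd wt) = arr (cong (1 ∷_) s) refl o ([-] ∷ c) [] wt , refl

  -- The two letters of a descent form a chain, hence a row of length 2.
  single-≅ : ∀ {β p d} →
    Arrangement (1 ∷ β) (1 + p) d ≅ (Arrangement β (2 + p) d ⟨⊎⟩ Arrangement (2 ∷ β) p d)
  single-≅ {β} {p} {d} = fromInverse to from to✓ (λ {y} → from✓ y)
    where
    to : Filling n × Word → (Filling n × Word) ⊎ (Filling n × Word)
    to ((x ∷ []) ∷ U , y ∷ w) with y ≺? x
    ... | yes _ = inj₂ ((y ∷ x ∷ []) ∷ U , w)
    ... | no _  = inj₁ (U , x ∷ y ∷ w)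
    to z = inj₁ z

    from : (Filling n × Word) ⊎ (Filling n × Word) → Filling n × Word
    from (inj₁ (U , x ∷ w))                = [ x ] ∷ U , w
    from (inj₂ ((y ∷ x ∷ []) ∷ U , w))     = [ x ] ∷ U , y ∷ w
    from (inj₁ z)                          = z
    from (inj₂ z)                          = z

    same : ∀ {x y} U w → y ≺ x → filling ([ x ] ∷ U , y ∷ w) ≃ filling ((y ∷ x ∷ []) ∷ U , w)
    same U w y≺x = ʳ++-≃ U (≃-trans (flip-≃ (map [_] w) y≺x) (pair-≃ (map [_] w) y≺x))

    to✓ : ∀ {z} → Arrangement (1 ∷ β) (1 + p) d z →
      (Arrangement β (2 + p) d ⟨⊎⟩ Arrangement (2 ∷ β) p d) (to z) × from (to z) ≡ z
    to✓ {(x ∷ []) ∷ U , y ∷ w} (arr s l o (_ ∷ c) nd wt) with y ≺? x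
    ... | yes y≺x = arr (cong (2 ∷_) (∷-injectiveʳ s)) (ℕ.suc-injective l) (once-≃ (same U w y≺x) o)
                        ((y≺x ∷ [-]) ∷ c) (Linked.tail nd) (weight-≃ (same U w y≺x) wt) , refl
    ... | no y⊀x  = arr (∷-injectiveʳ s) (cong suc l) o c (y⊀x ∷ nd) wt , refl

    from✓ : ∀ z → (Arrangement β (2 + p) d ⟨⊎⟩ Arrangement (2 ∷ β) p d) z →
      Arrangement (1 ∷ β) (1 + p) d (from z) × to (from z) ≡ z
    from✓ (inj₁ (U , x ∷ y ∷ w)) (arr s l o c (y⊀x ∷ nd) wt) with y ≺? x
    ... | yes y≺x = ⊥-elim (y⊀x y≺x)
    ... | no _    = arr (cong (1 ∷_) s) (ℕ.suc-injective l) o ([-] ∷ c) nd wt , refl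
    from✓ (inj₂ ((y ∷ x ∷ []) ∷ U , w)) (arr s l o ((y≺x ∷ [-]) ∷ c) nd wt) with y ≺? x
    ... | yes y≺x = arr (cong (1 ∷_) (∷-injectiveʳ s)) (cong suc l) (once-≃ (≃-sym (same U w y≺x)) o)
                        ([-] ∷ c) (noDescent-∷ w nd) (weight-≃ (≃-sym (same U w y≺x)) wt) , refl
      where
      -- Because y ≺ x, nothing lies below y, so y can be put in front of any word without a
      -- descent.
      noDescent-∷ : ∀ w → NoDescent w → NoDescent (y ∷ w)
      noDescent-∷ []      nd = [-]
      noDescent-∷ (z ∷ w) nd = (λ z≺y → no-chain z≺y y≺x) ∷ nd
    ... | no y⊀x  = ⊥-elim (y⊀x y≺x)

  -- b is the entry a_{s,1} of the exclusion condition for the column a ∷ xs; removing it leaves a ∷ zs.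
  data Pull (a : Fin n) : Word → Fin n → Word → Set where
    here  : ∀ {b ys} → a ≺ b → Pull a (b ∷ ys) b ys
    there : ∀ {y ys b zs} → y ≺ b → Pull a ys b zs → Pull a (y ∷ ys) b (y ∷ zs)

  Pull⇒≺ : ∀ {a xs b zs} → Pull a xs b zs → a ≺ b
  Pull⇒≺ (here a≺b)  = a≺b
  Pull⇒≺ (there _ p) = Pull⇒≺ p

  -- The pulled letter must be the first letter above a: passing a letter y with a ≺ y would require
  -- y ≺ b and give a chain.
  Pull-functional : ∀ {a xs b zs b′ zs′} → Pull a xs b zs → Pull a xs b′ zs′ → b ≡ b′ × zs ≡ zs′
  Pull-functional (here _)    (here _)     = refl , refl
  Pull-functional (here a≺y)  (there y≺b′ _) = ⊥-elim (no-chain a≺y y≺b′)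
  Pull-functional (there y≺b _) (here a≺y) = ⊥-elim (no-chain a≺y y≺b)
  Pull-functional (there _ p) (there _ p′) with Pull-functional p p′
  ... | refl , refl = refl , refl

  Pullable : Word → Set
  Pullable []       = ⊥
  Pullable (a ∷ xs) = ∃₂ λ b zs → Pull a xs b zs

  pull? : ∀ a xs → Dec (∃₂ λ b zs → Pull a xs b zs)
  pull? a []       = no λ ()
  pull? a (y ∷ ys) with a ≺? y
  ... | yes a≺y = yes (_ , _ , here a≺y)
  ... | no a⊀y with pull? a ys
  ...   | no ¬p = no λ { (_ , _ , here a≺y) → a⊀y a≺y ; (_ , _ , there _ p) → ¬p (_ , _ , p) }
  -- The tail offers a single candidate b by `Pull-functional`, so testing y ≺ b settles the matter.
  ...   | yes (b , zs , p) with y ≺? b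
  ...     | yes y≺b = yes (_ , _ , there y≺b p)
  ...     | no y⊀b  = no λ { (_ , _ , here a≺y) → a⊀y a≺y
                           ; (_ , _ , there y≺b p′) → y⊀b (subst (y ≺_) (sym (proj₁ (Pull-functional p p′))) y≺b) }

  pullable? : U.Decidable Pullable
  pullable? []       = no λ ()
  pullable? (a ∷ xs) = pull? a xs

  -- Puts b behind the longest initial run of letters below it. From an earlier place the next
  -- letter would form a descent with b, and from a later one b could not be pulled; this makes the
  -- removal of b reversible.
  insert : Fin n → Word → Word
  insert b []       = b ∷ []
  insert b (z ∷ zs) with z ≺? b
  ... | yes _ = z ∷ insert b zs
  ... | no _  = b ∷ z ∷ zs

  insert-Pull : ∀ {a b} zs → a ≺ b → Pull a (insert b zs) b zs
  insert-Pull         []       a≺b = here a≺b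
  insert-Pull {b = b} (z ∷ zs) a≺b with z ≺? b
  ... | yes z≺b = there z≺b (insert-Pull zs a≺b)
  ... | no _    = here a≺b

  Pull⇒insert : ∀ {a xs b zs} → NoDescent xs → Pull a xs b zs → insert b zs ≡ xs
  Pull⇒insert {zs = []} nd (here _) = refl
  Pull⇒insert {b = b} {zs = z ∷ zs} (z⊀b ∷ nd) (here _) with z ≺? b
  ... | yes z≺b = ⊥-elim (z⊀b z≺b)
  ... | no _    = refl
  Pull⇒insert {b = b} nd (there {y = y} y≺b p) with y ≺? b
  ... | yes _   = cong (y ∷_) (Pull⇒insert (Linked.tail nd) p)
  ... | no y⊀b  = ⊥-elim (y⊀b y≺b)

  length-Pull : ∀ {a xs b zs} → Pull a xs b zs → length xs ≡ suc (length zs)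
  length-Pull (here _)    = refl
  length-Pull (there _ p) = cong suc (length-Pull p)

  -- Removing b creates a new pair of neighbours, but each letter in front of b lies below b, hence
  -- is minimal and cannot begin a descent.
  Pull-NoDescent : ∀ {a xs b zs} → NoDescent xs → Pull a xs b zs → NoDescent zs
  Pull-NoDescent nd (here _)      = Linked.tail nd
  Pull-NoDescent nd (there y≺b p) = minimal-∷ y≺b (Pull-NoDescent (Linked.tail nd) p)
    where
    minimal-∷ : ∀ {y b zs} → y ≺ b → NoDescent zs → NoDescent (y ∷ zs)
    minimal-∷ {zs = []}    y≺b nd = [-]
    minimal-∷ {zs = _ ∷ _} y≺b nd = (λ z≺y → no-chain z≺y y≺b) ∷ nd

  insert-NoDescent : ∀ {a b} zs → a ≺ b → NoDescent zs → NoDescent (a ∷ insert b zs)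
  insert-NoDescent         []       a≺b nd = (λ b≺a → no-chain b≺a a≺b) ∷ [-]
  insert-NoDescent {b = b} (z ∷ zs) a≺b nd with z ≺? b
  ... | yes z≺b = (λ z≺a → no-chain z≺a a≺b) ∷ insert-NoDescent zs z≺b (Linked.tail nd)
  ... | no z⊀b  = (λ b≺a → no-chain b≺a a≺b) ∷ z⊀b ∷ nd

  -- On its way b passes only letters comparable to it, and these form no inversion with b in either
  -- order.
  insert-≃ : ∀ b zs → [ b ] ∷ map [_] zs ≃ map [_] (insert b zs)
  insert-≃ b []       = ≃-refl
  insert-≃ b (z ∷ zs) with z ≺? b
  ... | yes z≺b = ≃-trans (flip-≃ (map [_] zs) z≺b) (∷-≃ [ z ] (insert-≃ b zs))
  ... | no _    = ≃-refl

  -- For `α` consisting of ℓ twos these are the tableaux summed in C_ℓ, by `tableau-≅`.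
  Reduced : List ℕ → ℕ → ℕ → Filling n × Word → Set
  Reduced α p d x = Arrangement α p d x × ¬ Pullable (proj₂ x)

  reduced : List ℕ → ℕ → ℕ → List (Filling n × Word)
  reduced α p d = filter (¬? ∘ pullable? ∘ proj₂) (arrangements α p d)

  enumerates-reduced : ∀ α p d → Enumerates (Reduced α p d) (reduced α p d)
  enumerates-reduced α p d = enumerates-filter (¬? ∘ pullable? ∘ proj₂) (enumerates-arrangements α p d)

  pull-≅ : ∀ {β p d} → Arrangement β (2 + p) d ≅ (Reduced β (2 + p) d ⟨⊎⟩ Arrangement (2 ∷ β) p d)
  pull-≅ {β} {p} {d} = fromInverse to from to✓ (λ {y} → from✓ y)
    where
    to : Filling n × Word → (Filling n × Word) ⊎ (Filling n × Word)
    to (U , a ∷ xs) with pull? a xs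
    ... | yes (b , zs , _) = inj₂ ((a ∷ b ∷ []) ∷ U , zs)
    ... | no _             = inj₁ (U , a ∷ xs)
    to z = inj₁ z

    from : (Filling n × Word) ⊎ (Filling n × Word) → Filling n × Word
    from (inj₁ z)                      = z
    from (inj₂ ((a ∷ b ∷ []) ∷ U , w)) = U , a ∷ insert b w
    from (inj₂ z)                      = z

    same : ∀ {a b} U w → a ≺ b → filling ((a ∷ b ∷ []) ∷ U , w) ≃ filling (U , a ∷ insert b w)
    same {a} {b} U w a≺b = ʳ++-≃ U (≃-trans (≃-sym (pair-≃ (map [_] w) a≺b)) (∷-≃ [ a ] (insert-≃ b w)))

    to✓ : ∀ {z} → Arrangement β (2 + p) d z →
      (Reduced β (2 + p) d ⟨⊎⟩ Arrangement (2 ∷ β) p d) (to z) × from (to z) ≡ z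
    to✓ {U , a ∷ xs} A@(arr s l o c nd wt) with pull? a xs
    ... | no ¬p = (A , ¬p) , refl
    ... | yes (b , zs , p)
        with same′ ← subst (λ w → filling (U , a ∷ w) ≃ filling ((a ∷ b ∷ []) ∷ U , zs))
                       (Pull⇒insert (Linked.tail nd) p) (≃-sym (same U zs (Pull⇒≺ p)))
        = arr (cong (2 ∷_) s) (ℕ.suc-injective (trans (sym (length-Pull p)) (ℕ.suc-injective l)))
              (once-≃ same′ o) ((Pull⇒≺ p ∷ [-]) ∷ c) (Pull-NoDescent (Linked.tail nd) p) (weight-≃ same′ wt)
          , cong (λ w → U , a ∷ w) (Pull⇒insert (Linked.tail nd) p)

    from✓ : ∀ z → (Reduced β (2 + p) d ⟨⊎⟩ Arrangement (2 ∷ β) p d) z →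
      Arrangement β (2 + p) d (from z) × to (from z) ≡ z
    from✓ (inj₁ (U , a ∷ xs)) (A , ¬p) with pull? a xs
    ... | yes p = ⊥-elim (¬p p)
    ... | no _  = A , refl
    from✓ (inj₁ (U , [])) (arr s () o c nd wt , ¬p)
    from✓ (inj₂ ((a ∷ b ∷ []) ∷ U , zs)) (arr s l o ((a≺b ∷ [-]) ∷ c) nd wt) =
      arr (∷-injectiveʳ s) (cong suc (trans (length-Pull (insert-Pull zs a≺b)) (cong suc l)))
          (once-≃ (same U zs a≺b) o) c (insert-NoDescent zs a≺b nd) (weight-≃ (same U zs a≺b) wt)
      , back
      where
      back : to (U , a ∷ insert b zs) ≡ inj₂ ((a ∷ b ∷ []) ∷ U , zs)
      back with pull? a (insert b zs)
      ... | no ¬p = ⊥-elim (¬p (b , zs , insert-Pull zs a≺b))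
      ... | yes (_ , _ , p) with Pull-functional p (insert-Pull zs a≺b)
      ...   | refl , refl = refl

  short-reduced-≅ : ∀ {β p d} → p ≤ 1 → Arrangement β p d ≅ Reduced β p d
  short-reduced-≅ p≤1 = fromInverse id id (λ A → (A , short p≤1 (Arrangement.size A)) , refl) (λ (A , _) → A , refl)
    where
    short : ∀ {w p} → p ≤ 1 → length w ≡ p → ¬ Pullable w
    short {[]}        p≤1      eq   ()
    short {a ∷ []}    p≤1      eq   (_ , _ , ())
    short {a ∷ x ∷ w} (s≤s ()) refl _

  count-big : ∀ {α p d} → Any (3 ≤_) α → count α p d ≡ 0
  count-big {α} big = enumerates-∅ (λ { (arr refl _ _ c _ _) → absurd c big }) (enumerates-arrangements α _ _)
    where
    absurd : ∀ {U} → All (Linked _≺_) U → ¬ Any (3 ≤_) (map length U)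
    absurd {(_ ∷ []) ∷ _}        _                 (here (s≤s ()))
    absurd {(_ ∷ _ ∷ []) ∷ _}    _                 (here (s≤s (s≤s ())))
    absurd {(_ ∷ _ ∷ _ ∷ _) ∷ _} ((q ∷ r ∷ _) ∷ _) (here _)    = no-chain q r
    absurd {_ ∷ _}               (_ ∷ c)           (there big) = absurd c big

  count-sum : ∀ {α d} → sum α ≢ n → count α 0 d ≡ 0
  count-sum {α} ne = enumerates-∅ absurd (enumerates-arrangements α _ _)
    where
    absurd : ∀ {x} → ¬ Arrangement α 0 _ x
    absurd {U , []} (arr refl _ o _ _ _) = ne (begin
      sum (map length U)               ≡⟨ ℕ.+-identityʳ _ ⟨
      sum (map length U) + 0           ≡⟨ sum-map-ʳ++ length U [] ⟨
      sum (map length (U ʳ++ []))      ≡⟨ length-concat (U ʳ++ []) ⟨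
      length (concat (U ʳ++ []))       ≡⟨ ↭-length (EachOnce⇒↭ {xs = concat (U ʳ++ [])} o) ⟩
      length (allFin n)                ≡⟨ length-tabulate id ⟩
      n                                ∎)
      where open ≡-Reasoning

  countReduced : List ℕ → ℕ → ℕ → ℕ
  countReduced α p d = length (reduced α p d)

  count-0∷ : ∀ β p d → count (0 ∷ β) p d ≡ count β p d
  count-0∷ β p d = count-≅ (drop-empty-≅ {β} {p} {d})

  count-1∷-0 : ∀ β d → count (1 ∷ β) 0 d ≡ count β 1 d
  count-1∷-0 β d = count-≅ (last-single-≅ {β} {d})

  count-1∷-suc : ∀ β p d → count (1 ∷ β) (1 + p) d ≡ count β (2 + p) d + count (2 ∷ β) p d
  count-1∷-suc β p d = ≅⊎⇒length≡+ (single-≅ {β} {p} {d})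
    (enumerates-arrangements (1 ∷ β) (1 + p) d) (enumerates-arrangements β (2 + p) d) (enumerates-arrangements (2 ∷ β) p d)

  count-pull : ∀ β p d → count β (2 + p) d ≡ countReduced β (2 + p) d + count (2 ∷ β) p d
  count-pull β p d = ≅⊎⇒length≡+ (pull-≅ {β} {p} {d})
    (enumerates-arrangements β (2 + p) d) (enumerates-reduced β (2 + p) d) (enumerates-arrangements (2 ∷ β) p d)

  count-short : ∀ β {p} d → p ≤ 1 → count β p d ≡ countReduced β p d
  count-short β {p} d p≤1 = ≅⇒length≡ (short-reduced-≅ {β} {p} {d} p≤1)
    (enumerates-arrangements β p d) (enumerates-reduced β p d)

-- Solution of the recursions by binomial sums

sum-+ : ∀ (f g : A → ℕ) xs → sum (map (λ x → f x + g x) xs) ≡ sum (map f xs) + sum (map g xs)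
sum-+ f g []       = refl
sum-+ f g (x ∷ xs) = trans (cong (f x + g x +_) (sum-+ f g xs))
  (solve 4 (λ a b c d → (a :+ b) :+ (c :+ d) := (a :+ c) :+ (b :+ d)) refl (f x) (g x) _ _)
  where open +-*-Solver

sum-*-+ : ∀ (c f g : A → ℕ) xs →
  sum (map (λ x → c x * (f x + g x)) xs) ≡ sum (map (λ x → c x * f x) xs) + sum (map (λ x → c x * g x) xs)
sum-*-+ c f g xs = trans (sum-cong (λ x → ℕ.*-distribˡ-+ (c x) (f x) (g x)) xs)
  (sum-+ (λ x → c x * f x) (λ x → c x * g x) xs)

-- `binom 0 ℓ q` is the Kronecker delta of ℓ and q.
sum-*-binom₀ : ∀ (c : ℕ → ℕ) {q k} → q < k → sum (map (λ ℓ → c ℓ * binom 0 ℓ q) (upTo k)) ≡ c q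
sum-*-binom₀ c {q} {k} q<k = trans (cong sum (map-upTo (λ ℓ → c ℓ * binom 0 ℓ q) k)) (go c q<k)
  where
  zeros : ∀ (c : ℕ → ℕ) k → sum (applyUpTo (λ ℓ → c (suc ℓ) * 0) k) ≡ 0
  zeros c zero    = refl
  zeros c (suc k) = cong₂ _+_ (ℕ.*-zeroʳ (c 1)) (zeros (c ∘ suc) k)
  go : ∀ (c : ℕ → ℕ) {q k} → q < k → sum (applyUpTo (λ ℓ → c ℓ * binom 0 ℓ q) k) ≡ c q
  go c {zero}  {suc k} _         =
    trans (cong₂ _+_ (ℕ.*-identityʳ (c 0)) (zeros c k)) (ℕ.+-identityʳ (c 0))
  go c {suc q} {suc k} (s≤s q<k) = cong₂ _+_ (ℕ.*-zeroʳ (c 0)) (go (c ∘ suc) q<k)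

binom₀-< : ∀ {ℓ b} → ℓ < b → binom 0 ℓ b ≡ 0
binom₀-< {zero}  {suc b} _         = refl
binom₀-< {suc ℓ} {suc b} (s≤s ℓ<b) = binom₀-< ℓ<b

-- The multiplicity of C_ℓ in Y(1^s 2^q | p), i.e. the number of walks on ℕ that start at p, take s steps ±1,
-- and end at a height at least n − 2ℓ.  The closed form comes from the reflection principle.
binomSum : ℕ → ℕ → ℕ → ℕ → ℕ
binomSum s zero    q ℓ = binom s ℓ q
binomSum s (suc p) q ℓ = binom s ℓ q + binomSum s p (suc q) ℓ

binomSum-suc : ∀ s p q ℓ → binomSum (suc s) p q ℓ ≡ binomSum s p q ℓ + binomSum s p (suc q) ℓ
binomSum-suc s zero    q ℓ = refl
binomSum-suc s (suc p) q ℓ = trans (cong (binom s ℓ q + binom s ℓ (suc q) +_) (binomSum-suc s p (suc q) ℓ))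
  (solve 4 (λ a b c d → (a :+ b) :+ (c :+ d) := (a :+ c) :+ (b :+ d)) refl (binom s ℓ q) _ _ _)
  where open +-*-Solver

-- Pascal's rule in every summand, regrouped so that one sum gains the term that the other loses.
-- This is the recursion `count-1∷-suc`: a step up to 2 + p, or down to p with one more 2.
binomSum-step : ∀ s p q ℓ → binomSum (suc s) (suc p) q ℓ ≡ binomSum s (2 + p) q ℓ + binomSum s p (suc q) ℓ
binomSum-step s p q ℓ = trans (binomSum-suc s (suc p) q ℓ)
  (solve 3 (λ a b c → (a :+ b) :+ c := (a :+ c) :+ b) refl (binom s ℓ q) _ _)
  where open +-*-Solver

binomSum-last : ∀ s p q ℓ → binomSum s (suc p) q ℓ ≡ binomSum s p q ℓ + binom s ℓ (suc p + q)
binomSum-last s zero    q ℓ = refl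
binomSum-last s (suc p) q ℓ = trans (cong (binom s ℓ q +_) (binomSum-last s p (suc q) ℓ))
  (trans (sym (ℕ.+-assoc (binom s ℓ q) _ _))
         (cong (λ b → binomSum s (suc p) q ℓ + binom s ℓ b) (ℕ.+-suc (suc p) q)))

-- The order in which rows are consumed from the front: empty rows are dropped, rows of length 1
-- feed the walk, and the rows of length 2 remain for `count-2s`.
Profile⇒↭ : ∀ {α : Vec ℕ N} {s q} → Profile α s q →
  ∃[ z ] toList α ↭ replicate z 0 ++ replicate s 1 ++ replicate q 2
Profile⇒↭ []     = 0 , ↭-refl
Profile⇒↭ (0∷ p) with Profile⇒↭ p
... | z , r = suc z , prep 0 r
Profile⇒↭ (1∷_ {s = s} {q} p) with Profile⇒↭ p
... | z , r = z , ↭-trans (prep 1 r) (↭-sym (shift 1 (replicate z 0) (replicate s 1 ++ replicate q 2)))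
Profile⇒↭ (2∷_ {s = s} {q} p) with Profile⇒↭ p
... | z , r = z , ↭-trans (prep 2 (↭-trans r (↭-reflexive (sym (++-assoc (replicate z 0) (replicate s 1) _)))))
  (↭-trans (↭-sym (shift 2 (replicate z 0 ++ replicate s 1) (replicate q 2)))
           (↭-reflexive (++-assoc (replicate z 0) (replicate s 1) _)))

module Expansion {n : ℕ} (P : NaturalUnitIntervalOrder n)
    (no-chain : ∀ {a b c} → _<P_ P a b → _<P_ P b c → ⊥)
    (K : ℕ) (2K≤n : 2 * K ≤ n) (K-max : ∀ {q} → 2 * q ≤ n → q ≤ K) (d : ℕ) where
  open Arrangements P no-chain

  -- The coefficient of t^d in C_ℓ, as `length-tableaux` will show.
  c : ℕ → ℕ
  c ℓ = countReduced (replicate ℓ 2) (n ∸ 2 * ℓ) d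

  ∑c : (ℕ → ℕ) → ℕ
  ∑c f = sum (map (λ ℓ → c ℓ * f ℓ) (upTo (suc K)))

  ∑c-+ : ∀ f g → ∑c (λ ℓ → f ℓ + g ℓ) ≡ ∑c f + ∑c g
  ∑c-+ f g = sum-*-+ c f g (upTo (suc K))

  ∑c-cong : ∀ {f g} → (∀ ℓ → f ℓ ≡ g ℓ) → ∑c f ≡ ∑c g
  ∑c-cong f≡g = sum-cong (λ ℓ → cong (c ℓ *_) (f≡g ℓ)) (upTo (suc K))

  rest : ∀ q p → 2 * q + p ≡ n → p ≡ n ∸ 2 * q
  rest q p eq = trans (sym (ℕ.m+n∸m≡n (2 * q) p)) (cong (_∸ 2 * q) eq)

  c-short : ∀ q p → 2 * q + p ≡ n → p ≤ 1 → count (replicate q 2) p d ≡ c q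
  c-short q p eq p≤1 = trans (count-short (replicate q 2) d p≤1) (cong (λ k → countReduced (replicate q 2) k d) (rest q p eq))

  c-pull : ∀ q p → 2 * q + (2 + p) ≡ n → count (replicate q 2) (2 + p) d ≡ c q + count (replicate (suc q) 2) p d
  c-pull q p eq = trans (count-pull (replicate q 2) p d)
    (cong (λ k → countReduced (replicate q 2) k d + count (replicate (suc q) 2) p d) (rest q (2 + p) eq))

  -- The last term of the longer sum vanishes since q + p + 1 > K.
  ∑c-last : ∀ p q → 2 * q + suc p ≡ n → ∑c (binomSum 0 (suc p) q) ≡ ∑c (binomSum 0 p q)
  ∑c-last p q eq = sum-cong-∈ (upTo (suc K)) λ {ℓ} ℓ∈ → cong (c ℓ *_) (begin
    binomSum 0 (suc p) q ℓ                        ≡⟨ binomSum-last 0 p q ℓ ⟩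
    binomSum 0 p q ℓ + binom 0 ℓ (suc p + q)      ≡⟨ cong (binomSum 0 p q ℓ +_) (binom₀-< (ℕ.≤-trans (∈-upTo⁻ ℓ∈) K<)) ⟩
    binomSum 0 p q ℓ + 0                          ≡⟨ ℕ.+-identityʳ _ ⟩
    binomSum 0 p q ℓ                              ∎)
    where
    open ≡-Reasoning
    K< : K < suc p + q
    K< = ℕ.*-cancelˡ-< 2 K (suc p + q) (ℕ.≤-<-trans 2K≤n (subst (_< 2 * (suc p + q)) eq
      (ℕ.<-≤-trans (ℕ.+-monoʳ-< (2 * q) (ℕ.m<m+n (suc p) (s≤s z≤n))) (ℕ.≤-reflexive
        (solve 2 (λ p q → con 2 :* q :+ (p :+ p) := con 2 :* (p :+ q)) refl (suc p) q)))))
      where open +-*-Solver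

  -- Iterating `c-pull` yields c q + c (1 + q) + ... until at most one letter is left in the column.
  -- The deltas in `binomSum 0 p q` reach up to index q + p, while the column loses two letters at a
  -- time; the surplus indices lie above `K`, and `∑c-last` removes them.
  count-2s : ∀ p q → 2 * q + p ≡ n → count (replicate q 2) p d ≡ ∑c (binomSum 0 p q)
  count-2s zero q eq =
    trans (c-short q 0 eq z≤n) (sym (sum-*-binom₀ c (s≤s (K-max (ℕ.m+n≤o⇒m≤o (2 * q) (ℕ.≤-reflexive eq))))))
  count-2s (suc zero) q eq = begin
    count (replicate q 2) 1 d    ≡⟨ c-short q 1 eq ℕ.≤-refl ⟩
    c q                          ≡⟨ sum-*-binom₀ c (s≤s (K-max (ℕ.m+n≤o⇒m≤o (2 * q) (ℕ.≤-reflexive eq)))) ⟨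
    ∑c (binomSum 0 0 q)          ≡⟨ ∑c-last 0 q eq ⟨
    ∑c (binomSum 0 1 q)          ∎
    where open ≡-Reasoning
  count-2s (suc (suc p)) q eq = begin
    count (replicate q 2) (2 + p) d                                     ≡⟨ c-pull q p eq ⟩
    c q + count (replicate (suc q) 2) p d
      ≡⟨ cong₂ _+_ (sym (sum-*-binom₀ c (s≤s (K-max (ℕ.m+n≤o⇒m≤o (2 * q) (ℕ.≤-reflexive eq)))))) (count-2s p (suc q) eq′) ⟩
    ∑c (λ ℓ → binom 0 ℓ q) + ∑c (binomSum 0 p (suc q))                  ≡⟨ ∑c-+ (λ ℓ → binom 0 ℓ q) (binomSum 0 p (suc q)) ⟨
    ∑c (binomSum 0 (suc p) q)                                           ≡⟨ ∑c-last (suc p) q eq ⟨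
    ∑c (binomSum 0 (2 + p) q)                                           ∎
    where
    open ≡-Reasoning
    eq′ : 2 * suc q + p ≡ n
    eq′ = trans (solve 2 (λ p q → con 2 :* (con 1 :+ q) :+ p := con 2 :* q :+ (con 2 :+ p)) refl p q) eq
      where open +-*-Solver

  -- `binomSum` obeys the same recursions as `count`, by induction on the number of ones while `p`
  -- may grow. At p = 0 only the step up exists, and the two summands of `binomSum s 1 q` are
  -- Pascal's rule for 1 + s.
  count-1s2s : ∀ s p q → 2 * q + (s + p) ≡ n → count (replicate s 1 ++ replicate q 2) p d ≡ ∑c (binomSum s p q)
  count-1s2s zero    p       q eq = count-2s p q eq
  count-1s2s (suc s) zero    q eq = begin
    count (1 ∷ replicate s 1 ++ replicate q 2) 0 d   ≡⟨ count-1∷-0 (replicate s 1 ++ replicate q 2) d ⟩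
    count (replicate s 1 ++ replicate q 2) 1 d       ≡⟨ count-1s2s s 1 q (trans (cong (2 * q +_) (ℕ.+-suc s 0)) eq) ⟩
    ∑c (binomSum s 1 q)                              ∎
    where open ≡-Reasoning
  count-1s2s (suc s) (suc p) q eq = begin
    count (1 ∷ β) (suc p) d
      ≡⟨ count-1∷-suc β p d ⟩
    count β (2 + p) d + count (2 ∷ β) p d
      -- The new 2 stands in front of the ones; symmetry restores the form ones before twos.
      ≡⟨ cong (count β (2 + p) d +_) (count-↭ (↭-sym (shift 2 (replicate s 1) (replicate q 2))) p d) ⟩
    count β (2 + p) d + count (replicate s 1 ++ replicate (suc q) 2) p d
      ≡⟨ cong₂ _+_ (count-1s2s s (2 + p) q eq₁) (count-1s2s s p (suc q) eq₂) ⟩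
    ∑c (binomSum s (2 + p) q) + ∑c (binomSum s p (suc q))
      ≡⟨ ∑c-+ (binomSum s (2 + p) q) (binomSum s p (suc q)) ⟨
    ∑c (λ ℓ → binomSum s (2 + p) q ℓ + binomSum s p (suc q) ℓ)
      ≡⟨ ∑c-cong (binomSum-step s p q) ⟨
    ∑c (binomSum (suc s) (suc p) q)
      ∎
    where
    open ≡-Reasoning
    β = replicate s 1 ++ replicate q 2
    eq₁ : 2 * q + (s + (2 + p)) ≡ n
    eq₁ = trans (solve 3 (λ s p q → con 2 :* q :+ (s :+ (con 2 :+ p)) := con 2 :* q :+ ((con 1 :+ s) :+ (con 1 :+ p))) refl s p q) eq
      where open +-*-Solver
    eq₂ : 2 * suc q + (s + p) ≡ n
    eq₂ = trans (solve 3 (λ s p q → con 2 :* (con 1 :+ q) :+ (s :+ p) := con 2 :* q :+ ((con 1 :+ s) :+ (con 1 :+ p))) refl s p q) eq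
      where open +-*-Solver

  count-0s : ∀ z α p → count (replicate z 0 ++ α) p d ≡ count α p d
  count-0s zero    α p = refl
  count-0s (suc z) α p = trans (count-0∷ (replicate z 0 ++ α) p d) (count-0s z α p)

  count-profile : ∀ {α : Vec ℕ N} {s q} → Profile α s q → Vec.sum α ≡ n → count (toList α) 0 d ≡ ∑c (λ ℓ → binom s ℓ q)
  count-profile {α = α} {s} {q} p eq with Profile⇒↭ p
  ... | z , r = begin
    count (toList α) 0 d                                            ≡⟨ count-↭ r 0 d ⟩
    count (replicate z 0 ++ replicate s 1 ++ replicate q 2) 0 d     ≡⟨ count-0s z _ 0 ⟩
    count (replicate s 1 ++ replicate q 2) 0 d                      ≡⟨ count-1s2s s 0 q eq′ ⟩
    ∑c (λ ℓ → binom s ℓ q)                                          ∎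
    where
    open ≡-Reasoning
    eq′ : 2 * q + (s + 0) ≡ n
    eq′ = trans (solve 2 (λ s q → con 2 :* q :+ (s :+ con 0) := s :+ con 2 :* q) refl s q) (trans (sym (profile-sum p)) eq)
      where open +-*-Solver

-- Reduced arrangements are the tableaux of `C`

ʳ++-injective : ∀ (xs xs′ : List A) {ys ys′} → length xs ≡ length xs′ → xs ʳ++ ys ≡ xs′ ʳ++ ys′ → xs ≡ xs′ × ys ≡ ys′
ʳ++-injective []       []         _   eq = refl , eq
ʳ++-injective (x ∷ xs) (x′ ∷ xs′) len eq with ʳ++-injective xs xs′ (ℕ.suc-injective len) eq
... | refl , refl = refl , refl

map-[]-injective : ∀ (xs ys : List A) → map [_] xs ≡ map [_] ys → xs ≡ ys
map-[]-injective xs ys eq = trans (sym (concat-map-[] xs)) (trans (cong concat eq) (concat-map-[] ys))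

replicate-ʳ++ : ∀ k (x : A) ys → replicate k x ʳ++ ys ≡ replicate k x ++ ys
replicate-ʳ++ zero    x ys = refl
replicate-ʳ++ (suc k) x ys = trans (replicate-ʳ++ k x (x ∷ ys)) (lem k)
  where
  lem : ∀ k → replicate k x ++ x ∷ ys ≡ x ∷ replicate k x ++ ys
  lem zero    = refl
  lem (suc k) = cong (x ∷_) (lem k)

Linked-ʳ++⁻ : ∀ {R : A → A → Set} xs {ys} → Linked R (xs ʳ++ ys) → Linked R ys
Linked-ʳ++⁻ []       l = l
Linked-ʳ++⁻ (x ∷ xs) l = Linked.tail (Linked-ʳ++⁻ xs l)

row-∈ : ∀ {R : List (Fin n)} {T v} → v ∈ R → row (R ∷ T) v ≡ 0
row-∈ {R = R} {v = v} v∈ with _∈?_ Fin._≟_ v R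
... | yes _ = refl
... | no v∉ = ⊥-elim (v∉ v∈)

row-∉ : ∀ {R : List (Fin n)} {T v} → v ∉ R → row (R ∷ T) v ≡ suc (row T v)
row-∉ {R = R} {v = v} v∉ with _∈?_ Fin._≟_ v R
... | yes v∈ = ⊥-elim (v∉ v∈)
... | no _   = refl

unique-++⇒disjoint : ∀ (xs : List A) {ys v} → Unique (xs ++ ys) → v ∈ xs → v ∉ ys
unique-++⇒disjoint (x ∷ xs) (x∉ ∷ _)  (here refl) v∈ys = All.lookup x∉ (∈-++⁺ʳ xs v∈ys) refl
unique-++⇒disjoint (x ∷ xs) (_ ∷ xs!) (there v∈)  v∈ys = unique-++⇒disjoint xs xs! v∈ v∈ys

unique-++⇒uniqueʳ : ∀ (xs : List A) {ys} → Unique (xs ++ ys) → Unique ys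
unique-++⇒uniqueʳ []       u       = u
unique-++⇒uniqueʳ (x ∷ xs) (_ ∷ u) = unique-++⇒uniqueʳ xs u

-- Excluded P ℓ T is definitionally this condition for the column firstColumn T.
ExcludedColumn : (Fin n → Fin n → Set) → ℕ → List (Fin n) → Set
ExcludedColumn _≺_ ℓ col = ∃[ s ] ℓ + 2 ≤ suc (toℕ s)
  × (∀ i → ℓ + 1 ≤ suc (toℕ i) → i Fin.< s → lookup col i ≺ lookup col s)

-- The entries `as` stem from the rows of length 2, and the condition concerns only positions after
-- them.
ExcludedColumn-++⁻ : ∀ (_≺_ : Fin n → Fin n → Set) as {col} →
  ExcludedColumn _≺_ (length as) (as ++ col) → ExcludedColumn _≺_ 0 col
ExcludedColumn-++⁻ _≺_ []       ex                      = ex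
ExcludedColumn-++⁻ _≺_ (a ∷ as) (zero  , s≤s le , _) =
  ⊥-elim (ℕ.n≮0 (subst (_≤ 0) (ℕ.+-comm (length as) 2) le))
ExcludedColumn-++⁻ _≺_ (a ∷ as) (suc s , s≤s le , below) =
  ExcludedColumn-++⁻ _≺_ as (s , le , λ i le′ i<s → below (suc i) (s≤s le′) (s≤s i<s))

ExcludedColumn-++⁺ : ∀ (_≺_ : Fin n → Fin n → Set) as {col} →
  ExcludedColumn _≺_ 0 col → ExcludedColumn _≺_ (length as) (as ++ col)
ExcludedColumn-++⁺ _≺_ []       ex = ex
ExcludedColumn-++⁺ _≺_ (a ∷ as) ex with ExcludedColumn-++⁺ _≺_ as ex
... | s , le , below = suc s , s≤s le , λ
  { zero    (s≤s le′) _         → ⊥-elim (ℕ.n≮0 (subst (_≤ 0) (ℕ.+-comm (length as) 1) le′))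
  ; (suc i) (s≤s le′) (s≤s i<s) → below i le′ i<s }

module Tableaux {n : ℕ} (P : NaturalUnitIntervalOrder n)
    (no-chain : ∀ {a b c} → _<P_ P a b → _<P_ P b c → ⊥) where
  open Inversions P
  open Arrangements P no-chain

  Layered-⇔ : ∀ {_⊏_ _⊏′_ : Fin n → Fin n → Set} {T} →
    (∀ {u v} → u ∈ concat T → v ∈ concat T → (u ⊏ v → u ⊏′ v) × (u ⊏′ v → u ⊏ v)) →
    Layered _⊏_ T → Layered _⊏′_ T
  Layered-⇔ ⊏⇔⊏′ []                                  = []
  Layered-⇔ {T = R ∷ T} ⊏⇔⊏′ ((same , lower) ∷ layers) =
    ((λ u∈ v∈ → same u∈ v∈ ∘ proj₂ (⊏⇔⊏′ (∈-++⁺ˡ u∈) (∈-++⁺ˡ v∈)))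
    , (λ u∈ v∈ → proj₁ (⊏⇔⊏′ (∈-++⁺ˡ u∈) (∈-++⁺ʳ R v∈)) (proj₁ (lower u∈ v∈))
               , proj₂ (lower u∈ v∈) ∘ proj₂ (⊏⇔⊏′ (∈-++⁺ʳ R v∈) (∈-++⁺ˡ u∈))))
    ∷ Layered-⇔ (λ u∈ v∈ → ⊏⇔⊏′ (∈-++⁺ʳ R u∈) (∈-++⁺ʳ R v∈)) layers

  -- `row` reports the first row that contains a letter. By uniqueness a letter of the lower rows
  -- misses `R`, so a new top row shifts all their indices by one and keeps their order.
  row-layered : ∀ {T} → Unique (concat T) → Layered (λ u v → row T u < row T v) T
  row-layered {[]}    _  = []
  row-layered {R ∷ T} T! =
    ((λ u∈ v∈ lt → ℕ.n≮0 (subst (row (R ∷ T) _ <_) (row-∈ {T = T} v∈) lt))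
    , (λ u∈ v∈ → lower u∈ v∈))
    ∷ Layered-⇔ (λ u∈ v∈ → rows⇔ (fresh u∈) (fresh v∈)) (row-layered (unique-++⇒uniqueʳ R T!))
    where
    fresh : ∀ {v} → v ∈ concat T → v ∉ R
    fresh v∈T v∈R = unique-++⇒disjoint R T! v∈R v∈T
    lower : ∀ {u v} → u ∈ R → v ∈ concat T → row (R ∷ T) u < row (R ∷ T) v × ¬ row (R ∷ T) v < row (R ∷ T) u
    lower u∈ v∈ rewrite row-∈ {T = T} u∈ | row-∉ {T = T} (fresh v∈) = s≤s z≤n , λ ()
    rows⇔ : ∀ {u v} → u ∉ R → v ∉ R → (row T u < row T v → row (R ∷ T) u < row (R ∷ T) v)
                                    × (row (R ∷ T) u < row (R ∷ T) v → row T u < row T v)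
    rows⇔ u∉ v∉ rewrite row-∉ {T = T} u∉ | row-∉ {T = T} v∉ = s≤s , ℕ.≤-pred

  inv≡inversions : ∀ T → EachOnce (concat T) → inv (inc P) T ≡ inversions T
  inv≡inversions T once = length-edges (λ u v → row T u ℕ.<? row T v)
    (row-layered {T} (EachOnce⇒Unique {xs = concat T} once)) (EachOnce⇒↭ {xs = concat T} once)

  record Tableau (ℓ d : ℕ) (T : Filling n) : Set where
    field
      isPTableau  : IsPTableau P (twoColumn n ℓ) T
      notExcluded : ¬ Excluded P ℓ T
      weight      : inv (inc P) T ≡ d

  tableauxOfWeight : ℕ → ℕ → List (Filling n)
  tableauxOfWeight ℓ d = filter (λ T → inv (inc P) T ℕ.≟ d) (tableaux P ℓ)

  enumerates-tableaux : ∀ ℓ d → Enumerates (Tableau ℓ d) (tableauxOfWeight ℓ d)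
  enumerates-tableaux ℓ d = enumerates-⇔
    (λ ((_ , t , ¬e) , w) → record { isPTableau = t ; notExcluded = ¬e ; weight = w })
    (λ T✓ → let open Tableau T✓ in (IsPTableau.shape isPTableau , isPTableau , notExcluded) , weight)
    (enumerates-filter (λ T → inv (inc P) T ℕ.≟ d)
      (enumerates-filter (λ T → isPTableau? P (twoColumn n ℓ) T ×-dec ¬? (excluded? P ℓ T))
        (enumerates-fillings n (twoColumn n ℓ))))

  Pullable⇒Excluded : ∀ w → Pullable w → ExcludedColumn _≺_ 0 w
  Pullable⇒Excluded (a ∷ xs) (b , zs , p) with locate p
    where
    locate : ∀ {a xs b zs} → Pull a xs b zs → ∃[ s ] lookup xs s ≡ b × (∀ i → i Fin.< s → lookup xs i ≺ b)
    locate (here _)      = zero , refl , λ _ ()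
    locate (there y≺b p) with locate p
    ... | s , eq , below = suc s , eq , λ { zero _ → y≺b ; (suc i) (s≤s i<s) → below i i<s }
  ... | s , refl , below = suc s , s≤s (s≤s z≤n) , λ
    { zero _ _ → Pull⇒≺ p ; (suc i) _ (s≤s i<s) → below i i<s }

  Excluded⇒Pullable : ∀ w → ExcludedColumn _≺_ 0 w → Pullable w
  Excluded⇒Pullable (a ∷ xs) (zero , s≤s () , _)
  Excluded⇒Pullable (a ∷ xs) (suc s , _ , below) =
    _ , pull xs s (below zero (s≤s z≤n) (s≤s z≤n)) (λ i i<s → below (suc i) (s≤s z≤n) (s≤s i<s))
    where
    pull : ∀ xs (s : Fin (length xs)) → a ≺ lookup xs s → (∀ i → i Fin.< s → lookup xs i ≺ lookup xs s) →
      ∃[ zs ] Pull a xs (lookup xs s) zs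
    pull (x ∷ xs) zero    a≺b below = xs , here a≺b
    pull (x ∷ xs) (suc s) a≺b below with pull xs s a≺b (λ i i<s → below (suc i) (s≤s i<s))
    ... | zs , p = x ∷ zs , there (below zero (s≤s z≤n)) p

  firstColumn-map : ∀ (w : Word) → firstColumn (map [_] w) ≡ w
  firstColumn-map []      = refl
  firstColumn-map (x ∷ w) = cong (x ∷_) (firstColumn-map w)

  firstColumn-ʳ++ : ∀ ℓ {U} (T : Filling n) → map length U ≡ replicate ℓ 2 →
    ∃[ as ] length as ≡ ℓ × firstColumn (U ʳ++ T) ≡ as ++ firstColumn T
  firstColumn-ʳ++ zero    {[]}              T eq = [] , refl , refl
  firstColumn-ʳ++ (suc ℓ) {(a ∷ R) ∷ U} T eq with firstColumn-ʳ++ ℓ ((a ∷ R) ∷ T) (∷-injectiveʳ eq)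
  ... | as , len , eq′ = as ++ [ a ] , trans (length-++ as) (trans (ℕ.+-comm (length as) 1) (cong suc len))
                       , trans eq′ (sym (++-assoc as [ a ] (firstColumn T)))

  excluded-filling : ∀ ℓ {U : Filling n} w → map length U ≡ replicate ℓ 2 →
    (Excluded P ℓ (filling (U , w)) → Pullable w) × (Pullable w → Excluded P ℓ (filling (U , w)))
  excluded-filling ℓ {U} w eq with firstColumn-ʳ++ ℓ (map [_] w) eq
  ... | as , refl , eq′ =
    (λ ex → Excluded⇒Pullable w (ExcludedColumn-++⁻ _≺_ as (subst (ExcludedColumn _≺_ (length as)) eq″ ex)))
    , (λ p → subst (ExcludedColumn _≺_ (length as)) (sym eq″) (ExcludedColumn-++⁺ _≺_ as (Pullable⇒Excluded w p)))
    where
    eq″ : firstColumn (filling (U , w)) ≡ as ++ w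
    eq″ = trans eq′ (cong (as ++_) (firstColumn-map w))

  -- Under a row a ≺ b the column condition is automatic: c ≺ a would extend a ≺ b to a chain, and e
  -- ≺ b would extend the chain c ≺ e of the next row. This is why `Arrangement` asks for nothing
  -- there.
  columns-∷ : ∀ {R T} → length R ≡ 2 → Linked _≺_ R → All (Linked _≺_) T →
    Linked (ColumnsOK P) T → Linked (ColumnsOK P) (R ∷ T)
  columns-∷ {T = []}    len lR          lT        lc = [-]
  columns-∷ {R = a ∷ b ∷ []} {T = S ∷ T} len (a≺b ∷ [-]) (lS ∷ lT) lc = ok S lS ∷ lc
    where
    ok : ∀ S → Linked _≺_ S → ColumnsOK P (a ∷ b ∷ []) S
    ok []          lS          = []
    ok (c ∷ [])    lS          = (λ c≺a → no-chain c≺a a≺b) ∷ []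
    ok (c ∷ e ∷ S) (c≺e ∷ lS) = (λ c≺a → no-chain c≺a a≺b) ∷ (λ e≺b → no-chain c≺e e≺b) ∷ []

  columns-ʳ++ : ∀ ℓ {U T : Filling n} → map length U ≡ replicate ℓ 2 → All (Linked _≺_) U → All (Linked _≺_) T →
    Linked (ColumnsOK P) T → Linked (ColumnsOK P) (U ʳ++ T)
  columns-ʳ++ zero    {[]}    eq lU        lT lc = lc
  columns-ʳ++ (suc ℓ) {R ∷ U} eq (lR ∷ lU) lT lc =
    columns-ʳ++ ℓ (∷-injectiveʳ eq) lU (lR ∷ lT) (columns-∷ (∷-injectiveˡ eq) lR lT lc)

  noDescent⇒columns : ∀ {w} → NoDescent w → Linked (ColumnsOK P) (map [_] w)
  noDescent⇒columns nd = Linked.map⁺ (Linked.map (λ y⊀x → y⊀x ∷ []) nd)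

  columns⇒noDescent : ∀ {w} → Linked (ColumnsOK P) (map [_] w) → NoDescent w
  columns⇒noDescent lc = Linked.map (λ { (y⊀x ∷ []) → y⊀x }) (Linked.map⁻ lc)

  chains-map-[] : ∀ w → All (Linked _≺_) (map [_] w)
  chains-map-[] []      = []
  chains-map-[] (x ∷ w) = [-] ∷ chains-map-[] w

  map-length-[] : ∀ (w : Word) → map length (map [_] w) ≡ replicate (length w) 1
  map-length-[] []      = refl
  map-length-[] (x ∷ w) = cong (1 ∷_) (map-length-[] w)

  split-word : ∀ p (T : Filling n) → map length T ≡ replicate p 1 → ∃[ w ] T ≡ map [_] w × length w ≡ p
  split-word zero    []               eq = [] , refl , refl
  split-word (suc p) ((x ∷ []) ∷ T)   eq with split-word p T (∷-injectiveʳ eq)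
  ... | w , refl , len = x ∷ w , refl , cong suc len

  split-filling : ∀ ℓ p k (U T : Filling n) → map length U ≡ replicate k 2 → map length T ≡ replicate ℓ 2 ++ replicate p 1 →
    ∃₂ λ U′ w → U ʳ++ T ≡ filling (U′ , w) × map length U′ ≡ replicate (ℓ + k) 2 × length w ≡ p
  split-filling zero    p k U T eqU eqT with split-word p T eqT
  ... | w , refl , len = U , w , refl , eqU , len
  split-filling (suc ℓ) p k U (R ∷ T) eqU eqT
    with split-filling ℓ p (suc k) (R ∷ U) T (cong₂ _∷_ (∷-injectiveˡ eqT) eqU) (∷-injectiveʳ eqT)
  ... | U′ , w , eq , eqU′ , len = U′ , w , eq , trans eqU′ (cong (λ j → replicate j 2) (ℕ.+-suc ℓ k)) , len

  -- The shape fixes the number of upper rows, so `filling` can be undone; column conditions survive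
  -- only inside the word, as `NoDescent`, and exclusion becomes `Pullable`.
  tableau-≅ : ∀ ℓ d → Reduced (replicate ℓ 2) (n ∸ 2 * ℓ) d ≅ Tableau ℓ d
  tableau-≅ ℓ d = record { to = filling ; to-∈ = to-∈ ; injective = injective ; surjective = surjective }
    where
    p = n ∸ 2 * ℓ

    to-∈ : ∀ {x} → Reduced (replicate ℓ 2) p d x → Tableau ℓ d (filling x)
    to-∈ {U , w} (arr s l o c nd wt , ¬p) = record
      { isPTableau  = record
        { shape    = begin
            map length (U ʳ++ map [_] w)                 ≡⟨ map-ʳ++ length U ⟩
            map length U ʳ++ map length (map [_] w)      ≡⟨ cong₂ _ʳ++_ s (trans (map-length-[] w) (cong (λ k → replicate k 1) l)) ⟩
            replicate ℓ 2 ʳ++ replicate p 1              ≡⟨ replicate-ʳ++ ℓ 2 (replicate p 1) ⟩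
            twoColumn n ℓ                                ∎
        ; eachOnce = o
        ; rows     = All-resp-↭ (++↭ʳ++ U (map [_] w)) (All.++⁺ c (chains-map-[] w))
        ; columns  = columns-ʳ++ ℓ s c (chains-map-[] w) (noDescent⇒columns nd)
        }
      ; notExcluded = ¬p ∘ proj₁ (excluded-filling ℓ w s)
      ; weight      = trans (inv≡inversions (filling (U , w)) o) wt
      }
      where open ≡-Reasoning

    injective : ∀ {x y} → Reduced (replicate ℓ 2) p d x → Reduced (replicate ℓ 2) p d y → filling x ≡ filling y → x ≡ y
    injective {U , w} {U′ , w′} (A , _) (A′ , _) eq
      with ʳ++-injective U U′ (trans (size≡ℓ A) (sym (size≡ℓ A′))) eq
      where
      size≡ℓ : ∀ {U w} → Arrangement (replicate ℓ 2) p d (U , w) → length U ≡ ℓ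
      size≡ℓ {U} A = trans (sym (length-map length U))
        (trans (cong length (Arrangement.shape A)) (length-replicate ℓ))
    ... | refl , eq′ = cong (U ,_) (map-[]-injective w w′ eq′)

    surjective : ∀ {T} → Tableau ℓ d T → ∃[ x ] Reduced (replicate ℓ 2) p d x × filling x ≡ T
    surjective {T} T✓ with split-filling ℓ p 0 [] T refl (IsPTableau.shape (Tableau.isPTableau T✓))
    ... | U , w , refl , s , len =
      (U , w) , (arr s′ len eachOnce (proj₁ (All.++⁻ U (All-resp-↭ (↭-sym (++↭ʳ++ U (map [_] w))) rows)))
                     (columns⇒noDescent (Linked-ʳ++⁻ U columns)) (trans (sym (inv≡inversions (filling (U , w)) eachOnce)) weight)
                 , notExcluded ∘ proj₂ (excluded-filling ℓ w s′)) , refl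
      where
      open Tableau T✓
      open IsPTableau isPTableau
      s′ : map length U ≡ replicate ℓ 2
      s′ = trans s (cong (λ k → replicate k 2) (ℕ.+-identityʳ ℓ))

  length-tableaux : ∀ ℓ d → length (tableauxOfWeight ℓ d) ≡ countReduced (replicate ℓ 2) (n ∸ 2 * ℓ) d
  length-tableaux ℓ d = sym (≅⇒length≡ (tableau-≅ ℓ d) (enumerates-reduced _ _ d) (enumerates-tableaux ℓ d))

-- Proper colourings are the arrangements without a column

length-filter-tabulate : ∀ {Q : B → Set} {R : A → Set} (Q? : U.Decidable Q) (R? : U.Decidable R)
  (f : Fin n → B) (κ : Vec A n) → (∀ v → Q (f v) → R (Vec.lookup κ v)) → (∀ v → R (Vec.lookup κ v) → Q (f v)) →
  length (filter Q? (tabulate f)) ≡ Vec.count R? κ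
length-filter-tabulate Q? R? f []      Q⇒R R⇒Q = refl
length-filter-tabulate Q? R? f (x ∷ κ) Q⇒R R⇒Q
  with ih ← length-filter-tabulate Q? R? (f ∘ suc) κ (Q⇒R ∘ suc) (R⇒Q ∘ suc) | Q? (f zero) | R? x
... | yes _ | yes _ = cong suc ih
... | no _  | no _  = ih
... | yes q | no ¬r = ⊥-elim (¬r (Q⇒R zero q))
... | no ¬q | yes r = ⊥-elim (¬q (R⇒Q zero r))

toList-tabulate : ∀ (f : Fin n → A) → toList (Vec.tabulate f) ≡ tabulate f
toList-tabulate {n = zero}  f = refl
toList-tabulate {n = suc n} f = cong (f zero ∷_) (toList-tabulate (f ∘ suc))

toList-injective : ∀ {xs ys : Vec A n} → toList xs ≡ toList ys → xs ≡ ys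
toList-injective eq = trans (sym (Vec.cast-is-id refl _)) (Vec.toList-injective refl _ _ eq)

map-≡⇒ : ∀ {f g : A → B} {xs} → map f xs ≡ map g xs → ∀ {x} → x ∈ xs → f x ≡ g x
map-≡⇒ {xs = _ ∷ _} eq (here refl) = ∷-injectiveˡ eq
map-≡⇒ {xs = _ ∷ _} eq (there x∈)  = map-≡⇒ (∷-injectiveʳ eq) x∈

AllPairs-restrict : ∀ {Q : A → Set} {R : A → A → Set} {xs} →
  All Q xs → AllPairs (λ x y → Q x → Q y → R x y) xs → AllPairs R xs
AllPairs-restrict []         []           = []
AllPairs-restrict (qx ∷ qxs) (rxs ∷ pairs) =
  All.zipWith (λ (qy , r) → r qx qy) (qxs , rxs) ∷ AllPairs-restrict qxs pairs

sorted-≡ : ∀ {xs ys : List (Fin n)} → AllPairs Fin._<_ xs → AllPairs Fin._<_ ys →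
  (∀ {v} → v ∈ xs → v ∈ ys) → (∀ {v} → v ∈ ys → v ∈ xs) → xs ≡ ys
sorted-≡ {xs = []}     {[]}     _ _ xs⊆ys ys⊆xs = refl
sorted-≡ {xs = []}     {y ∷ ys} _ _ xs⊆ys ys⊆xs with ys⊆xs (here refl)
... | ()
sorted-≡ {xs = x ∷ xs} {[]}     _ _ xs⊆ys ys⊆xs with xs⊆ys (here refl)
... | ()
sorted-≡ {xs = x ∷ xs} {y ∷ ys} (x< ∷ sxs) (y< ∷ sys) xs⊆ys ys⊆xs with x≡y (xs⊆ys (here refl)) (ys⊆xs (here refl))
  where
  x≡y : x ∈ y ∷ ys → y ∈ x ∷ xs → x ≡ y
  x≡y (here eq)  _          = eq
  x≡y (there _)  (here eq)  = sym eq
  x≡y (there x∈) (there y∈) = ⊥-elim (ℕ.<-asym (All.lookup y< x∈) (All.lookup x< y∈))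
... | refl = cong (x ∷_) (sorted-≡ sxs sys
  (λ v∈ → tail x< v∈ (xs⊆ys (there v∈))) (λ v∈ → tail y< v∈ (ys⊆xs (there v∈))))
  where
  tail : ∀ {v zs ws} → All (x Fin.<_) zs → v ∈ zs → v ∈ x ∷ ws → v ∈ ws
  tail x<zs v∈zs (here refl) = ⊥-elim (ℕ.<-irrefl refl (All.lookup x<zs v∈zs))
  tail x<zs v∈zs (there v∈)  = v∈

concat-ʳ++-↭ : ∀ (U V : List (List A)) → concat (U ʳ++ V) ↭ concat U ++ concat V
concat-ʳ++-↭ []      V = ↭-refl
concat-ʳ++-↭ (R ∷ U) V = ↭-trans (concat-ʳ++-↭ U (R ∷ V))
  (↭-trans (shifts (concat U) R) (↭-reflexive (sym (List.++-assoc R (concat U) (concat V)))))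

unique-concat⇒index≡ : ∀ (T : List (List A)) → Unique (concat T) →
  ∀ {v} i j → v ∈ List.lookup T i → v ∈ List.lookup T j → i ≡ j
unique-concat⇒index≡ (R ∷ T) T! zero    zero    v∈ v∈′ = refl
unique-concat⇒index≡ (R ∷ T) T! zero    (suc j) v∈ v∈′ =
  ⊥-elim (unique-++⇒disjoint R T! v∈ (∈-concat⁺′ v∈′ (∈-lookup {xs = T} j)))
unique-concat⇒index≡ (R ∷ T) T! (suc i) zero    v∈ v∈′ =
  ⊥-elim (unique-++⇒disjoint R T! v∈′ (∈-concat⁺′ v∈ (∈-lookup {xs = T} i)))
unique-concat⇒index≡ (R ∷ T) T! (suc i) (suc j) v∈ v∈′ =
  cong suc (unique-concat⇒index≡ T (unique-++⇒uniqueʳ R T!) i j v∈ v∈′)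

module Colorings {n : ℕ} (P : NaturalUnitIntervalOrder n)
    (no-chain : ∀ {a b c} → _<P_ P a b → _<P_ P b c → ⊥) where
  open Inversions P
  open Arrangements P no-chain

  color : Vec (Fin N) n → Fin n → Fin N
  color = Vec.lookup

  class : Vec (Fin N) n → Fin N → Word
  class κ c = filter (λ v → color κ v Fin.≟ c) (allFin n)

  -- Read as upper rows from bottom to top, larger colours stand higher. An edge whose smaller end
  -- has the smaller colour then has that end in the lower row: ascents are inversions.
  classes : Vec (Fin N) n → Filling n
  classes {N} κ = map (class κ) (allFin N)

  ∈-class⁺ : ∀ {κ : Vec (Fin N) n} {c v} → color κ v ≡ c → v ∈ class κ c
  ∈-class⁺ {κ = κ} {c} eq = ∈-filter⁺ (λ v → color κ v Fin.≟ c) (∈-allFin _) eq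

  ∈-class⁻ : ∀ {κ : Vec (Fin N) n} {c v} → v ∈ class κ c → color κ v ≡ c
  ∈-class⁻ {κ = κ} {c} v∈ = proj₂ (∈-filter⁻ (λ v → color κ v Fin.≟ c) {xs = allFin n} v∈)

  classes-shape : ∀ (κ : Vec (Fin N) n) → map length (classes κ) ≡ toList (content (inc P) κ)
  classes-shape {N} κ = begin
    map length (map (class κ) (allFin N))                   ≡⟨ map-∘ (allFin N) ⟨
    map (length ∘ class κ) (allFin N)                       ≡⟨ map-cong size (allFin N) ⟩
    map (λ c → Vec.count (c Fin.≟_) κ) (allFin N)           ≡⟨ map-tabulate id _ ⟩
    tabulate (λ c → Vec.count (c Fin.≟_) κ)                 ≡⟨ toList-tabulate _ ⟨
    toList (content (inc P) κ)                              ∎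
    where
    open ≡-Reasoning
    size : ∀ c → length (class κ c) ≡ Vec.count (c Fin.≟_) κ
    size c = length-filter-tabulate (λ v → color κ v Fin.≟ c) (c Fin.≟_) id κ (λ _ → sym) (λ _ → sym)

  classes-once : ∀ (κ : Vec (Fin N) n) → EachOnce (concat (filling (classes κ , [])))
  classes-once {N} κ = EachOnce-↭ (↭-sym (↭-trans (concat-ʳ++-↭ (classes κ) []) (↭-reflexive (++-identityʳ _))))
    λ v → length-filter≟ classes! (covers v)
    where
    disjoint : ∀ {c c′} → c ≢ c′ → Disjoint (class κ c) (class κ c′)
    disjoint c≢c′ (v∈ , v∈′) = c≢c′ (trans (sym (∈-class⁻ {κ = κ} v∈)) (∈-class⁻ {κ = κ} v∈′))
    classes! : Unique (concat (classes κ))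
    classes! = Unique.concat⁺
      (All.map⁺ (All.tabulate λ {c} _ → Unique.filter⁺ (λ v → color κ v Fin.≟ c) (Unique.allFin⁺ n)))
      (AllPairs.map⁺ {f = class κ} (AllPairs.map disjoint (Unique.allFin⁺ N)))
    covers : ∀ v → v ∈ concat (classes κ)
    covers v = ∈-concat⁺′ (∈-class⁺ {κ = κ} refl) (∈-map⁺ (class κ) (∈-allFin (color κ v)))

  -- `T` accumulates the classes already placed, whose colours are all smaller than those in `cs`.
  classes-layered : ∀ (κ : Vec (Fin N) n) {cs T} → AllPairs Fin._<_ cs →
    (∀ {v} → v ∈ concat T → All (color κ v Fin.<_) cs) →
    Layered (λ u v → color κ v Fin.< color κ u) T →
    Layered (λ u v → color κ v Fin.< color κ u) (map (class κ) cs ʳ++ T)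
  classes-layered κ {[]}     []          T<cs layers = layers
  classes-layered κ {c ∷ cs} {T} (c< ∷ pairs) T<cs layers = classes-layered κ pairs T′<cs ((same , lower) ∷ layers)
    where
    same : ∀ {u v} → u ∈ class κ c → v ∈ class κ c → ¬ color κ v Fin.< color κ u
    same u∈ v∈ lt = Fin.<-irrefl (trans (∈-class⁻ {κ = κ} v∈) (sym (∈-class⁻ {κ = κ} u∈))) lt
    lower : ∀ {u v} → u ∈ class κ c → v ∈ concat T → color κ v Fin.< color κ u × ¬ color κ u Fin.< color κ v
    lower {u} {v} u∈ v∈ = v<u , λ u<v → ℕ.<-asym v<u u<v
      where
      v<u : color κ v Fin.< color κ u
      v<u = subst (color κ v Fin.<_) (sym (∈-class⁻ {κ = κ} u∈)) (All.head (T<cs v∈))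
    T′<cs : ∀ {v} → v ∈ class κ c ++ concat T → All (color κ v Fin.<_) cs
    T′<cs {v} v∈ with ∈-++⁻ (class κ c) v∈
    ... | inj₁ v∈c = subst (λ c → All (c Fin.<_) cs) (sym (∈-class⁻ {κ = κ} v∈c)) c<
    ... | inj₂ v∈T = All.tail (T<cs v∈T)

  classes-weight : ∀ (κ : Vec (Fin N) n) → asc (inc P) κ ≡ inversions (filling (classes κ , []))
  classes-weight {N} κ = length-edges (λ u v → color κ v Fin.<? color κ u)
    (classes-layered κ {allFin N} (AllPairs.tabulate⁺-< id) (λ ()) [])
    (EachOnce⇒↭ {xs = concat (filling (classes κ , []))} (classes-once κ))

  allFin-sorted : AllPairs Fin._<_ (allFin n)
  allFin-sorted = AllPairs.tabulate⁺-< id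

  -- Members of a class are pairwise non-adjacent, and for u < v this means u ≺ v.
  classes-chains : ∀ (κ : Vec (Fin N) n) → Proper (inc P) κ → All (Linked _≺_) (classes κ)
  classes-chains {N} κ proper = All.map⁺ (All.tabulate {xs = allFin N} λ {c} _ → Linked.AllPairs⇒Linked (chain c))
    where
    chain : ∀ c → AllPairs _≺_ (class κ c)
    chain c = AllPairs-restrict {Q = λ v → color κ v ≡ c} (All.tabulate (∈-class⁻ {κ = κ}))
      (AllPairs.map below (AllPairs.filter⁺ (λ v → color κ v Fin.≟ c) allFin-sorted))
      where
      below : ∀ {u v} → u Fin.< v → color κ u ≡ c → color κ v ≡ c → u ≺ v
      below {u} {v} u<v equ eqv with u ≺? v
      ... | yes u≺v = u≺v
      ... | no u⊀v  = ⊥-elim (proper u v (inj₁ (<∧⊀⇒edge u<v u⊀v)) (trans equ (sym eqv)))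

  record Coloring (α : Vec ℕ N) (d : ℕ) (κ : Vec (Fin N) n) : Set where
    field
      proper   : Proper (inc P) κ
      content≡ : content (inc P) κ ≡ α
      asc≡     : asc (inc P) κ ≡ d

  coloringsOfWeight : Vec ℕ N → ℕ → List (Vec (Fin N) n)
  coloringsOfWeight α d = filter (λ κ → asc (inc P) κ ℕ.≟ d) (coloringsWithContent (inc P) α)

  enumerates-colorings : ∀ (α : Vec ℕ N) d → Enumerates (Coloring α d) (coloringsOfWeight α d)
  enumerates-colorings {N} α d = enumerates-⇔
    (λ ((_ , p , c) , a) → record { proper = p ; content≡ = c ; asc≡ = a })
    (λ κ✓ → let open Coloring κ✓ in (tt , proper , content≡) , asc≡)
    (enumerates-filter (λ κ → asc (inc P) κ ℕ.≟ d)
      (enumerates-filter (λ κ → proper? (inc P) κ ×-dec Vec.≡-dec ℕ._≟_ (content (inc P) κ) α)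
        (enumerates-vectors (enumerates-allFin N) n)))

  chain-pairs : ∀ {R} → Linked _≺_ R → AllPairs _≺_ R
  chain-pairs = Linked.Linked⇒AllPairs λ p q → ⊥-elim (no-chain p q)

  -- Each element is coloured by the index of its row. Chains and colour classes are both listed by
  -- increasing label, so class and row agree as lists and not only as sets.
  classes-surjective : ∀ {U} → EachOnce (concat U) → All (Linked _≺_) U →
    ∃[ κ ] Proper (inc P) κ × classes {length U} κ ≡ U
  classes-surjective {U} once chains = κ , proper , (begin
    map (class κ) (allFin (length U))     ≡⟨ map-tabulate id (class κ) ⟩
    tabulate (class κ)                    ≡⟨ List.tabulate-cong class≡row ⟩
    tabulate (List.lookup U)              ≡⟨ tabulate-lookup U ⟩
    U                                     ∎)
    where
    open ≡-Reasoning
    any : ∀ v → Any (v ∈_) U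
    any v = ∈-concat⁻ U (EachOnce⇒∈ once v)
    κ : Vec (Fin (length U)) n
    κ = Vec.tabulate (λ v → Any.index (any v))
    ∈-row : ∀ v → v ∈ List.lookup U (color κ v)
    ∈-row v = subst (λ i → v ∈ List.lookup U i) (sym (Vec.lookup∘tabulate _ v)) (Any.lookup-index (any v))
    row-chain : ∀ c → AllPairs _≺_ (List.lookup U c)
    row-chain c = chain-pairs (All.lookup chains (∈-lookup c))
    class≡row : ∀ c → class κ c ≡ List.lookup U c
    class≡row c = sorted-≡ (AllPairs.filter⁺ (λ v → color κ v Fin.≟ c) allFin-sorted)
      (AllPairs.map ≺⇒< (row-chain c))
      (λ {v} v∈ → subst (λ i → v ∈ List.lookup U i) (∈-class⁻ {κ = κ} v∈) (∈-row v))
      (λ {v} v∈ → ∈-class⁺ {κ = κ} (unique-concat⇒index≡ U (EachOnce⇒Unique once) (color κ v) c (∈-row v) v∈))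
    proper : Proper (inc P) κ
    proper i j i~j eq
      with ∈-AllPairs₂ (row-chain (color κ j)) (subst (λ c → i ∈ List.lookup U c) eq (∈-row i)) (∈-row j) | i~j
    ... | inj₁ refl       | _      = Graph.irrefl (inc P) i~j
    ... | inj₂ (inj₁ i≺j) | inj₁ e = ≺⇒¬edge i≺j e
    ... | inj₂ (inj₁ i≺j) | inj₂ e = ≺⇒¬edge˘ i≺j e
    ... | inj₂ (inj₂ j≺i) | inj₁ e = ≺⇒¬edge˘ j≺i e
    ... | inj₂ (inj₂ j≺i) | inj₂ e = ≺⇒¬edge j≺i e

  coloring-≅ : ∀ (α : Vec ℕ N) d → Coloring α d ≅ Arrangement (toList α) 0 d
  coloring-≅ {N} α d = record
    { to = λ κ → classes κ , [] ; to-∈ = to-∈ ; injective = injective ; surjective = λ {x} → surjective α {x} }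
    where
    to-∈ : ∀ {κ} → Coloring α d κ → Arrangement (toList α) 0 d (classes κ , [])
    to-∈ {κ} κ✓ = arr (trans (classes-shape κ) (cong toList content≡)) refl (classes-once κ)
      (classes-chains κ proper) [] (trans (sym (classes-weight κ)) asc≡)
      where open Coloring κ✓

    injective : ∀ {κ κ′} → Coloring α d κ → Coloring α d κ′ → (classes κ , []) ≡ (classes κ′ , []) → κ ≡ κ′
    injective {κ} {κ′} _ _ eq = begin
      κ                          ≡⟨ Vec.tabulate∘lookup κ ⟨
      Vec.tabulate (color κ)     ≡⟨ Vec.tabulate-cong same ⟩
      Vec.tabulate (color κ′)    ≡⟨ Vec.tabulate∘lookup κ′ ⟩
      κ′                         ∎
      where
      open ≡-Reasoning
      same : ∀ v → color κ v ≡ color κ′ v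
      same v = sym (∈-class⁻ {κ = κ′}
        (subst (v ∈_) (map-≡⇒ (cong proj₁ eq) (∈-allFin (color κ v))) (∈-class⁺ {κ = κ} refl)))

    surjective : ∀ {N} (α : Vec ℕ N) {x} → Arrangement (toList α) 0 d x → ∃[ κ ] Coloring α d κ × (classes κ , []) ≡ x
    surjective α {U , []} (arr s l o c nd wt)
      with trans (sym (length-map length U)) (trans (cong length s) (Vec.length-toList α))
    ... | refl with classes-surjective {U} (EachOnce-↭ (↭-trans (concat-ʳ++-↭ U []) (↭-reflexive (++-identityʳ _))) o) c
    ...   | κ , proper , eq = κ , record
      { proper   = proper
      ; content≡ = toList-injective (trans (sym (classes-shape κ)) (trans (cong (map length) eq) s))
      ; asc≡     = trans (classes-weight κ) (trans (cong (λ U → inversions (filling (U , []))) eq) wt)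
      } , cong (_, []) eq

  length-colorings : ∀ (α : Vec ℕ N) d → length (coloringsOfWeight α d) ≡ count (toList α) 0 d
  length-colorings α d = ≅⇒length≡ (coloring-≅ α d) (enumerates-colorings α d) (enumerates-arrangements (toList α) 0 d)

-- The expansion and e-positivity

sum-toList : ∀ (α : Vec ℕ N) → sum (toList α) ≡ Vec.sum α
sum-toList []      = refl
sum-toList (a ∷ α) = cong (a +_) (sum-toList α)

any-toList : ∀ {Q : ℕ → Set} {α : Vec ℕ N} → VecAny.Any Q α → Any Q (toList α)
any-toList (VecAny.here q)  = here q
any-toList (VecAny.there a) = there (any-toList a)

-- IsPartition forbids the part 0 of (n , 0).
partition : ℕ → ℕ → List ℕ
partition n zero    = n ∷ []
partition n (suc ℓ) = (n ∸ suc ℓ) ∷ suc ℓ ∷ []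

e[partition]≈ : ∀ n ℓ (α : Vec ℕ N) → e[ partition n ℓ ] α ≈ₚ const (eeCoeff (n ∸ ℓ) ℓ α)
e[partition]≈ n zero    α = subst (λ k → e[ n ∷ [] ] α ≈ₚ const k) (sym (eeCoeff-0 n α)) (e[x]≈ n α)
e[partition]≈ n (suc ℓ) α = e[x,y]≈ (n ∸ suc ℓ) (suc ℓ) α

coeff-eCombination : ∀ (c : ℕ → Poly) (λs : ℕ → List ℕ) ℓs (α : Vec ℕ N) →
  eCombination (map (λ ℓ → c ℓ , λs ℓ) ℓs) α ≡ ∑ₚ (map (λ ℓ → c ℓ *ₚ e[ λs ℓ ] α) ℓs)
coeff-eCombination c λs []       α = refl
coeff-eCombination c λs (ℓ ∷ ℓs) α = cong (c ℓ *ₚ e[ λs ℓ ] α +ₚ_) (coeff-eCombination c λs ℓs α)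

-- Makes k = ⌊n/2⌋ positive: for n = 1 the convention m_n = n would force r = n.
2≤n : ∀ {n} (P : NaturalUnitIntervalOrder n) {r} → m P 1 ≡ r → r < n → 2 ≤ n
2≤n {suc (suc n)} P m₁≡r r<n = s≤s (s≤s z≤n)
2≤n {1} P {zero}  m₁≡0 _ with trans (sym m₁≡0) (NaturalUnitIntervalOrder.m-last P)
... | ()
2≤n {1} P {suc r} _ (s≤s ())

module _ {n : ℕ} (P : NaturalUnitIntervalOrder n) {r : ℕ} (m₁≡r : m P 1 ≡ r) (m-next : m P (r + 1) ≡ n) where
  open NaturalUnitIntervalOrder P using (m-mono)

  -- From a ≺ b follows b > m_a ≥ m_1 = r, so, for b < n, m_b ≥ m_{r+1} = n and nothing lies above
  -- b.
  no-chain : ∀ {a b c} → _<P_ P a b → _<P_ P b c → ⊥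
  no-chain {a} {b} {c} (a<n , ma<b) (b<n , mb<c) = ℕ.<⇒≱ mb<c (ℕ.≤-trans (Fin.toℕ<n c) n≤mb)
    where
    r<b : r + 1 ≤ label b
    r<b = subst (_≤ label b) (ℕ.+-comm 1 r)
      (ℕ.≤-<-trans (subst (_≤ m P (label a)) m₁≡r (m-mono ℕ.≤-refl (s≤s z≤n) a<n)) ma<b)
    n≤mb : n ≤ m P (label b)
    n≤mb = subst (_≤ m P (label b)) m-next (m-mono (ℕ.m≤n+m 1 r) r<b b<n)

  K : ℕ
  K = ℕ.⌊ n /2⌋

  2K≤n : 2 * K ≤ n
  2K≤n = ℕ.≤-trans (ℕ.+-monoʳ-≤ K (subst (_≤ ℕ.⌈ n /2⌉) (sym (ℕ.+-identityʳ K)) (ℕ.⌊n/2⌋≤⌈n/2⌉ n)))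
    (ℕ.≤-reflexive (ℕ.⌊n/2⌋+⌈n/2⌉≡n n))

  K-max : ∀ {q} → 2 * q ≤ n → q ≤ K
  K-max {q} 2q≤n = subst (_≤ K) (trans (cong ℕ.⌊_/2⌋ (cong (q +_) (ℕ.+-identityʳ q))) (sym (ℕ.n≡⌊n+n/2⌋ q)))
    (ℕ.⌊n/2⌋-mono 2q≤n)

  open Tableaux P no-chain
  open Colorings P no-chain

  tableauCount : ℕ → ℕ → ℕ
  tableauCount d ℓ = length (tableauxOfWeight ℓ d)

  coeff-C : ∀ ℓ d → coeff (C P ℓ) d ≡ ⁺ tableauCount d ℓ
  coeff-C ℓ d = coeff-∑ₚt^ (inv (inc P)) (tableaux P ℓ) d

  C-nonNegative : ∀ ℓ → NonNegative (C P ℓ)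
  C-nonNegative ℓ d = subst (ℤ.0ℤ ℤ.≤_) (sym (coeff-C ℓ d)) (ℤ.+≤+ z≤n)

  coeff-sum : ∀ {f : ℕ → Series} (α : Vec ℕ N) d → (∀ ℓ → f ℓ α ≈ₚ const (eeCoeff (n ∸ ℓ) ℓ α)) → ∀ ℓs →
    coeff (∑ₚ (map (λ ℓ → C P ℓ *ₚ f ℓ α) ℓs)) d ≡ ⁺ sum (map (λ ℓ → tableauCount d ℓ * eeCoeff (n ∸ ℓ) ℓ α) ℓs)
  coeff-sum {f = f} α d f≈ = coeff-∑ₚ λ ℓ → begin
    coeff (C P ℓ *ₚ f ℓ α) d                              ≡⟨ ≈const⇒coeff-*ₚ (f≈ ℓ) (C P ℓ) d ⟩
    coeff (C P ℓ) d ℤ.* ⁺ eeCoeff (n ∸ ℓ) ℓ α             ≡⟨ cong (ℤ._* ⁺ eeCoeff (n ∸ ℓ) ℓ α) (coeff-C ℓ d) ⟩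
    ⁺ tableauCount d ℓ ℤ.* ⁺ eeCoeff (n ∸ ℓ) ℓ α          ≡⟨ ℤ.pos-* (tableauCount d ℓ) _ ⟨
    ⁺ (tableauCount d ℓ * eeCoeff (n ∸ ℓ) ℓ α)            ∎
    where open ≡-Reasoning

  ℓ≤n : ∀ {ℓ} → ℓ ≤ K → ℓ ≤ n
  ℓ≤n ℓ≤K = ℕ.≤-trans ℓ≤K (ℕ.⌊n/2⌋≤n n)

  -- Both sides vanish if the degree is not n or some exponent exceeds 2. Otherwise the walk started
  -- at p = 0 gives C_ℓ the multiplicity s choose ℓ - q, which is also the coefficient of x^α in
  -- e_{n-ℓ} e_ℓ.
  count≡sum : ∀ (α : Vec ℕ N) d → length (coloringsOfWeight α d)
    ≡ sum (map (λ ℓ → tableauCount d ℓ * eeCoeff (n ∸ ℓ) ℓ α) (upTo (suc K)))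
  count≡sum α d with Vec.sum α ℕ.≟ n
  ... | no ne = trans (length-colorings α d) (trans (count-sum {toList α} {d} (ne ∘ trans (sym (sum-toList α)))) (sym (vanish
    λ {ℓ} ℓ≤K → eeCoeff-sum (n ∸ ℓ) ℓ α λ eq → ne (sym (trans (sym (ℕ.m∸n+n≡m (ℓ≤n ℓ≤K))) eq)))))
    where
    open Arrangements P no-chain using (count-sum)
    vanish : (∀ {ℓ} → ℓ ≤ K → eeCoeff (n ∸ ℓ) ℓ α ≡ 0) →
      sum (map (λ ℓ → tableauCount d ℓ * eeCoeff (n ∸ ℓ) ℓ α) (upTo (suc K))) ≡ 0
    vanish ee≡0 = trans (sum-cong-∈ (upTo (suc K)) λ {ℓ} ℓ∈ →
      trans (cong (tableauCount d ℓ *_) (ee≡0 (ℕ.≤-pred (∈-upTo⁻ ℓ∈)))) (ℕ.*-zeroʳ (tableauCount d ℓ)))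
      (sum-zero (λ _ → refl) (upTo (suc K)))
  ... | yes eq with profile α
  ...   | inj₂ big = trans (length-colorings α d) (trans (count-big {toList α} {0} {d} (any-toList big)) (sym
    (sum-zero (λ ℓ → trans (cong (tableauCount d ℓ *_) (eeCoeff-big (n ∸ ℓ) ℓ big)) (ℕ.*-zeroʳ (tableauCount d ℓ))) (upTo (suc K)))))
    where open Arrangements P no-chain using (count-big)
  ...   | inj₁ (s , q , p) = begin
    length (coloringsOfWeight α d)
      ≡⟨ length-colorings α d ⟩
    count (toList α) 0 d
      ≡⟨ Expansion.count-profile P no-chain K 2K≤n K-max d p eq ⟩
    sum (map (λ ℓ → Expansion.c P no-chain K 2K≤n K-max d ℓ * binom s ℓ q) (upTo (suc K)))
      ≡⟨ sum-cong-∈ (upTo (suc K)) (λ {ℓ} ℓ∈ → cong₂ _*_ (length-tableaux ℓ d)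
           (eeCoeff≡binom (n ∸ ℓ) ℓ p (trans (ℕ.m∸n+n≡m (ℓ≤n (ℕ.≤-pred (∈-upTo⁻ ℓ∈)))) (sym eq)))) ⟨
    sum (map (λ ℓ → tableauCount d ℓ * eeCoeff (n ∸ ℓ) ℓ α) (upTo (suc K)))
      ∎
    where
    open ≡-Reasoning
    open Arrangements P no-chain using (count)

  -- Only the coefficients of `f ℓ` at `α` matter, so the result serves both for e_{n-ℓ} e_ℓ with
  -- its factor e_0 at ℓ = 0 and for genuine partitions.
  chromatic-expansion : ∀ {f : ℕ → Series} (α : Vec ℕ N) → (∀ ℓ → f ℓ α ≈ₚ const (eeCoeff (n ∸ ℓ) ℓ α)) →
    chromatic (inc P) α ≈ₚ ∑ₚ (map (λ ℓ → C P ℓ *ₚ f ℓ α) (upTo (suc K)))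
  chromatic-expansion {f = f} α f≈ d = begin
    coeff (chromatic (inc P) α) d                                  ≡⟨ coeff-∑ₚt^ (asc (inc P)) (coloringsWithContent (inc P) α) d ⟩
    ⁺ length (coloringsOfWeight α d)                               ≡⟨ cong ⁺_ (count≡sum α d) ⟩
    ⁺ sum (map (λ ℓ → tableauCount d ℓ * eeCoeff (n ∸ ℓ) ℓ α) (upTo (suc K)))
      ≡⟨ coeff-sum {f = f} α d f≈ (upTo (suc K)) ⟨
    coeff (∑ₚ (map (λ ℓ → C P ℓ *ₚ f ℓ α) (upTo (suc K)))) d       ∎
    where open ≡-Reasoning

  partition-isPartition : 1 ≤ n → ∀ {ℓ} → ℓ ≤ K → IsPartition (partition n ℓ)
  partition-isPartition 1≤n {zero}  ℓ≤K = [-] , 1≤n ∷ []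
  partition-isPartition 1≤n {suc ℓ} ℓ≤K = (ℓ≤n-ℓ ∷ [-]) , ℕ.≤-trans (s≤s z≤n) ℓ≤n-ℓ ∷ s≤s z≤n ∷ []
    where
    ℓ≤n-ℓ : suc ℓ ≤ n ∸ suc ℓ
    ℓ≤n-ℓ = ℕ.m+n≤o⇒m≤o∸n (suc ℓ) (ℕ.≤-trans (ℕ.+-mono-≤ ℓ≤K (subst (suc ℓ ≤_) (sym (ℕ.+-identityʳ K)) ℓ≤K)) 2K≤n)

  ePositive : 1 ≤ n → EPositive (chromatic (inc P))
  ePositive 1≤n = map (λ ℓ → C P ℓ , partition n ℓ) (upTo (suc K))
    , All.map⁺ (All.tabulate λ {ℓ} ℓ∈ → C-nonNegative ℓ , partition-isPartition 1≤n (ℕ.≤-pred (∈-upTo⁻ ℓ∈)))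
    , λ α → subst (chromatic (inc P) α ≈ₚ_) (sym (coeff-eCombination (C P) (partition n) (upTo (suc K)) α))
        (chromatic-expansion {f = λ ℓ → e[ partition n ℓ ]} α (λ ℓ → e[partition]≈ n ℓ α))

theorem3p3 : (n : ℕ) (P : NaturalUnitIntervalOrder n) (r : ℕ) →
    m P 1 ≡ r → r < n → m P (r + 1) ≡ n →
    (∃[ k ] (1 ≤ k × 2 * k ≤ n
    × (chromatic (inc P) ≈ₛ (∑[ℓ≤ k ] (λ ℓ → C P ℓ · e[ (n ∸ ℓ) ∷ ℓ ∷ [] ])))
    × (∀ ℓ → ℓ ≤ k → NonNegative (C P ℓ))))
    × EPositive (chromatic (inc P))
theorem3p3 n P r m₁≡r r<n m-next =
  (K P m₁≡r m-next , ℕ.⌊n/2⌋-mono (2≤n P m₁≡r r<n) , 2K≤n P m₁≡r m-next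
    , (λ α → chromatic-expansion P m₁≡r m-next {f = λ ℓ → e[ (n ∸ ℓ) ∷ ℓ ∷ [] ]} α (λ ℓ → e[x,y]≈ (n ∸ ℓ) ℓ α))
    , λ ℓ _ → C-nonNegative P m₁≡r m-next ℓ)
  , ePositive P m₁≡r m-next (ℕ.≤-trans (s≤s z≤n) r<n)
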